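{- Let $q\ge2$ be fixed and let $A$ be a finite set with $|A|=q$. The proportion of permutations $f$ of $A^n$ (among all $(q^n)!$ permutations of $A^n$) whose procedural complexity $\mathcal{L}(f)$ is at least $$\left\lfloor \frac{n\log q-1}{q^{ -1}\log (q!)+q^{ -n}\log n}\right\rfloor+1$$ tends to $1$ when $n$ tends to infinity, where $\log$ is the natural logarithm.
   Context: A transformation of $A^n$ is a map $f=(f_1,\dots,f_n):A^n\to A^n$; its coordinate function $f_i:A^n\to A$ is trivial if $f_i(x)=x_i$ for all $x$. An instruction is a transformation of $A^n$ with at most one nontrivial coordinate function. A program of length $L$ computing $f$ is a sequence of instructions $g^1,\dots,g^L$ with $f=g^L\circ\cdots\circ g^1$. The procedural complexity $\mathcal{L}(f)$ is the shortest length of a program computing $f$; the identity has procedural complexity $0$. -}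

module Defs where

open import Data.Fin.Base using (Fin)
open import Data.Integer.Base as ℤ using (ℤ; +_)
import Data.Integer.Properties as ℤₚ
open import Data.List.Base using (List; []; _∷_; length)
open import Data.Nat.Base as ℕ using (ℕ; zero; suc; _!; z≤n; s≤s)
import Data.Nat.Properties as ℕₚ
open import Data.Nat.Solver renaming (module +-*-Solver to ℕ-Solver)
open import Data.Product.Base using (Σ; ∃; _×_; _,_; proj₁; proj₂)
open import Data.Rational.Base as ℚ using (ℚ; 0ℚ; 1ℚ; ½; mkℚ; ∣_∣)
import Data.Rational.Properties as ℚₚ
open import Data.Rational.Solver renaming (module +-*-Solver to ℚ-Solver)
import Data.Rational.Unnormalised.Base as ℚᵘ
import Data.Rational.Unnormalised.Properties as ℚᵘₚ
open import Data.Sum.Base using (inj₁; inj₂)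
open import Data.Vec.Base using (Vec; lookup)
open import Function.Base using (_∘_; id)
open import Function.Bundles using (Inverse; _↔_)
open import Relation.Binary.Bundles using (Setoid)
import Relation.Binary.Construct.On as On
open import Relation.Binary.PropositionalEquality
  using (_≡_; refl; sym; trans; cong; cong₂; subst; subst₂; setoid; _→-setoid_)
open import Relation.Nullary using (¬_)

SeqCauchy : (ℕ → ℚ) → Set
SeqCauchy s = ∀ ε → 0ℚ ℚ.< ε →
  ∃ λ N → ∀ m n → N ℕ.≤ m → N ℕ.≤ n → ∣ s m ℚ.- s n ∣ ℚ.< ε

TendsTo : (ℕ → ℚ) → ℚ → Set
TendsTo s l = ∀ ε → 0ℚ ℚ.< ε → ∃ λ N → ∀ n → N ℕ.≤ n → ∣ s n ℚ.- l ∣ ℚ.< ε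

∑ : ℕ → (ℕ → ℚ) → ℚ
∑ zero    f = 0ℚ
∑ (suc n) f = f 0 ℚ.+ ∑ n (f ∘ suc)

module CauchyLemmas where
  half>0 : ∀ {ε} → 0ℚ ℚ.< ε → 0ℚ ℚ.< ½ ℚ.* ε
  half>0 {ε} ε>0 = ℚₚ.positive⁻¹ _ {{ℚₚ.pos*pos⇒pos ½ ε {{ℚ.positive ε>0}}}}

  half+half : ∀ ε → ½ ℚ.* ε ℚ.+ ½ ℚ.* ε ≡ ε
  half+half ε = trans (sym (ℚₚ.*-distribʳ-+ ε ½ ½)) (ℚₚ.*-identityˡ ε)

  ≤⊔ˡ : ∀ {a b n} → a ℕ.⊔ b ℕ.≤ n → a ℕ.≤ n
  ≤⊔ˡ {a} {b} = ℕₚ.≤-trans (ℕₚ.m≤m⊔n a b)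

  ≤⊔ʳ : ∀ {a b n} → a ℕ.⊔ b ℕ.≤ n → b ℕ.≤ n
  ≤⊔ʳ {a} {b} = ℕₚ.≤-trans (ℕₚ.m≤n⊔m a b)

  *-mono-≤ : ∀ {a b c d} → 0ℚ ℚ.≤ a → 0ℚ ℚ.≤ d →
             a ℚ.≤ b → c ℚ.≤ d → a ℚ.* c ℚ.≤ b ℚ.* d
  *-mono-≤ {a} {b} {c} {d} a≥0 d≥0 a≤b c≤d = ℚₚ.≤-trans
    (ℚₚ.*-monoˡ-≤-nonNeg a {{ℚ.nonNegative a≥0}} c≤d)
    (ℚₚ.*-monoʳ-≤-nonNeg d {{ℚ.nonNegative d≥0}} a≤b)

  scale : ∀ B ε → 0ℚ ℚ.< B → 0ℚ ℚ.< ε → ∃ λ δ → 0ℚ ℚ.< δ × B ℚ.* δ ≡ ε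
  scale B ε B>0 ε>0 = 1/B ℚ.* ε
    , ℚₚ.positive⁻¹ _ {{ℚₚ.pos*pos⇒pos 1/B {{ℚₚ.1/pos⇒pos B {{B⁺}}}} ε {{ℚ.positive ε>0}}}}
    , trans (sym (ℚₚ.*-assoc B 1/B ε))
        (trans (cong (ℚ._* ε) (ℚₚ.*-inverseʳ B {{nz}})) (ℚₚ.*-identityˡ ε))
    where
    B⁺ = ℚ.positive B>0
    nz = ℚₚ.pos⇒nonZero B {{B⁺}}
    1/B = (ℚ.1/ B) {{nz}}

  module _ where
    open ℚ-Solver
    +-shuffle : ∀ a b c d → (a ℚ.+ b) ℚ.- (c ℚ.+ d) ≡ (a ℚ.- c) ℚ.+ (b ℚ.- d)
    +-shuffle = solve 4 (λ a b c d → (a :+ b) :- (c :+ d) := (a :- c) :+ (b :- d)) refl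
    neg-shuffle : ∀ a c → (ℚ.- a) ℚ.- (ℚ.- c) ≡ ℚ.- (a ℚ.- c)
    neg-shuffle = solve 2 (λ a c → (:- a) :- (:- c) := :- (a :- c)) refl
    *-shuffle : ∀ a b c d → a ℚ.* b ℚ.- c ℚ.* d ≡ a ℚ.* (b ℚ.- d) ℚ.+ (a ℚ.- c) ℚ.* d
    *-shuffle = solve 4 (λ a b c d → a :* b :- c :* d := a :* (b :- d) :+ (a :- c) :* d) refl
    add-sub : ∀ a b → a ≡ b ℚ.+ (a ℚ.- b)
    add-sub = solve 2 (λ a b → a := b :+ (a :- b)) refl
    inv-shuffle : ∀ r s a b → (r ℚ.* s) ℚ.* (b ℚ.- a) ≡ r ℚ.* (s ℚ.* b) ℚ.- s ℚ.* (r ℚ.* a)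
    inv-shuffle = solve 4 (λ r s a b → (r :* s) :* (b :- a) := r :* (s :* b) :- s :* (r :* a)) refl
    sub-cancel : ∀ a b → (a ℚ.+ b) ℚ.- b ≡ a
    sub-cancel = solve 2 (λ a b → (a :+ b) :- b := a) refl

  bounded : ∀ {s} → SeqCauchy s →
            ∃ λ B → 0ℚ ℚ.< B × ∃ λ N → ∀ n → N ℕ.≤ n → ∣ s n ∣ ℚ.≤ B
  bounded {s} c with c 1ℚ (ℚₚ.positive⁻¹ 1ℚ)
  ... | N , h = ∣ s N ∣ ℚ.+ 1ℚ
    , ℚₚ.positive⁻¹ _ {{ℚₚ.nonNeg+pos⇒pos ∣ s N ∣ {{ℚₚ.∣-∣-nonNeg (s N)}} 1ℚ}}
    , N , λ n N≤n → subst (λ t → ∣ t ∣ ℚ.≤ ∣ s N ∣ ℚ.+ 1ℚ) (sym (add-sub (s n) (s N)))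
        (ℚₚ.≤-trans (ℚₚ.∣p+q∣≤∣p∣+∣q∣ (s N) (s n ℚ.- s N))
          (ℚₚ.+-monoʳ-≤ ∣ s N ∣ (ℚₚ.<⇒≤ (h n N N≤n ℕₚ.≤-refl))))

  +-cauchy : ∀ {s t} → SeqCauchy s → SeqCauchy t → SeqCauchy (λ n → s n ℚ.+ t n)
  +-cauchy {s} {t} cs ct ε ε>0
    with cs (½ ℚ.* ε) (half>0 ε>0) | ct (½ ℚ.* ε) (half>0 ε>0)
  ... | N , h | M , k = N ℕ.⊔ M , λ m n Nm Nn →
    subst₂ (λ u v → ∣ u ∣ ℚ.< v) (sym (+-shuffle (s m) (t m) (s n) (t n))) (half+half ε)
      (ℚₚ.≤-<-trans (ℚₚ.∣p+q∣≤∣p∣+∣q∣ (s m ℚ.- s n) (t m ℚ.- t n))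
        (ℚₚ.+-mono-< (h m n (≤⊔ˡ Nm) (≤⊔ˡ Nn)) (k m n (≤⊔ʳ {N} Nm) (≤⊔ʳ {N} Nn))))

  neg-cauchy : ∀ {s} → SeqCauchy s → SeqCauchy (λ n → ℚ.- s n)
  neg-cauchy {s} cs ε ε>0 with cs ε ε>0
  ... | N , h = N , λ m n Nm Nn →
    subst (ℚ._< ε)
      (sym (trans (cong ∣_∣ (neg-shuffle (s m) (s n))) (ℚₚ.∣-p∣≡∣p∣ (s m ℚ.- s n))))
      (h m n Nm Nn)

  *-estimate : ∀ a b c d B C δ η ε → 0ℚ ℚ.< B → 0ℚ ℚ.< C →
    B ℚ.* δ ≡ ½ ℚ.* ε → C ℚ.* η ≡ ½ ℚ.* ε → ∣ a ∣ ℚ.≤ B → ∣ d ∣ ℚ.≤ C →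
    ∣ b ℚ.- d ∣ ℚ.< δ → ∣ a ℚ.- c ∣ ℚ.< η → ∣ a ℚ.* b ℚ.- c ℚ.* d ∣ ℚ.< ε
  *-estimate a b c d B C δ η ε B>0 C>0 Bδ Cη a≤B d≤C b-d<δ a-c<η =
    subst₂ (λ u v → ∣ u ∣ ℚ.< v) (sym (*-shuffle a b c d)) (half+half ε)
      (ℚₚ.≤-<-trans (ℚₚ.∣p+q∣≤∣p∣+∣q∣ (a ℚ.* (b ℚ.- d)) ((a ℚ.- c) ℚ.* d))
        (ℚₚ.+-mono-< left right))
    where
    left : ∣ a ℚ.* (b ℚ.- d) ∣ ℚ.< ½ ℚ.* ε
    left = subst₂ ℚ._<_ (sym (ℚₚ.∣p*q∣≡∣p∣*∣q∣ a (b ℚ.- d))) Bδ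
      (ℚₚ.≤-<-trans
        (ℚₚ.*-monoʳ-≤-nonNeg ∣ b ℚ.- d ∣ {{ℚₚ.∣-∣-nonNeg (b ℚ.- d)}} a≤B)
        (ℚₚ.*-monoʳ-<-pos B {{ℚ.positive B>0}} b-d<δ))
    right : ∣ (a ℚ.- c) ℚ.* d ∣ ℚ.< ½ ℚ.* ε
    right = subst₂ ℚ._<_
      (sym (trans (ℚₚ.∣p*q∣≡∣p∣*∣q∣ (a ℚ.- c) d) (ℚₚ.*-comm ∣ a ℚ.- c ∣ ∣ d ∣)))
      Cη
      (ℚₚ.≤-<-trans
        (ℚₚ.*-monoʳ-≤-nonNeg ∣ a ℚ.- c ∣ {{ℚₚ.∣-∣-nonNeg (a ℚ.- c)}} d≤C)
        (ℚₚ.*-monoʳ-<-pos C {{ℚ.positive C>0}} a-c<η))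

  *-cauchy : ∀ {s t} → SeqCauchy s → SeqCauchy t → SeqCauchy (λ n → s n ℚ.* t n)
  *-cauchy {s} {t} cs ct ε ε>0 =
    let B , B>0 , P , hB = bounded {s} cs
        C , C>0 , Q , hC = bounded {t} ct
        δ , δ>0 , Bδ = scale B (½ ℚ.* ε) B>0 (half>0 ε>0)
        η , η>0 , Cη = scale C (½ ℚ.* ε) C>0 (half>0 ε>0)
        N , h = ct δ δ>0
        M , k = cs η η>0
    in (P ℕ.⊔ Q) ℕ.⊔ (N ℕ.⊔ M) , λ m n Lm Ln →
      *-estimate (s m) (t m) (s n) (t n) B C δ η ε B>0 C>0 Bδ Cη
        (hB m (≤⊔ˡ {P} {Q} (≤⊔ˡ {P ℕ.⊔ Q} Lm)))
        (hC n (≤⊔ʳ {P} {Q} (≤⊔ˡ {P ℕ.⊔ Q} Ln)))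
        (h m n (≤⊔ˡ {N} {M} (≤⊔ʳ {P ℕ.⊔ Q} Lm)) (≤⊔ˡ {N} {M} (≤⊔ʳ {P ℕ.⊔ Q} Ln)))
        (k m n (≤⊔ʳ {N} {M} (≤⊔ʳ {P ℕ.⊔ Q} Lm)) (≤⊔ʳ {N} {M} (≤⊔ʳ {P ℕ.⊔ Q} Ln)))

  module Recip (ε : ℚ) (ε>0 : 0ℚ ℚ.< ε) where
    ⊔>0 : ∀ p → 0ℚ ℚ.< p ℚ.⊔ ε
    ⊔>0 p = ℚₚ.<-≤-trans ε>0 (ℚₚ.p≤q⊔p p ε)

    recip : ℚ → ℚ
    recip p = (ℚ.1/ (p ℚ.⊔ ε)) {{ℚ.>-nonZero (⊔>0 p)}}

    recip>0 : ∀ p → 0ℚ ℚ.< recip p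
    recip>0 p = ℚₚ.positive⁻¹ _ {{ℚₚ.1/pos⇒pos (p ℚ.⊔ ε) {{ℚ.positive (⊔>0 p)}}}}

    recip-inv : ∀ p → ε ℚ.≤ p → recip p ℚ.* p ≡ 1ℚ
    recip-inv p ε≤p = trans (cong (recip p ℚ.*_) (sym (ℚₚ.p≥q⇒p⊔q≡p ε≤p)))
      (ℚₚ.*-inverseˡ (p ℚ.⊔ ε) {{ℚ.>-nonZero (⊔>0 p)}})

    E = recip ε

    recip≤E : ∀ p → ε ℚ.≤ p → recip p ℚ.≤ E
    recip≤E p ε≤p = subst₂ ℚ._≤_
      (trans (ℚₚ.*-assoc (recip p) ε E)
        (trans (cong (recip p ℚ.*_) (trans (ℚₚ.*-comm ε E) (recip-inv ε ℚₚ.≤-refl)))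
          (ℚₚ.*-identityʳ (recip p))))
      (trans (cong (ℚ._* E) (recip-inv p ε≤p)) (ℚₚ.*-identityˡ E))
      (ℚₚ.*-monoʳ-≤-nonNeg E {{ℚ.nonNegative (ℚₚ.<⇒≤ (recip>0 ε))}}
        (ℚₚ.*-monoˡ-≤-nonNeg (recip p) {{ℚ.nonNegative (ℚₚ.<⇒≤ (recip>0 p))}} ε≤p))

    recip-diff : ∀ p q → ε ℚ.≤ p → ε ℚ.≤ q →
                 ∣ recip p ℚ.- recip q ∣ ℚ.≤ (E ℚ.* E) ℚ.* ∣ q ℚ.- p ∣
    recip-diff p q ε≤p ε≤q = subst (ℚ._≤ (E ℚ.* E) ℚ.* ∣ q ℚ.- p ∣) eq
      (ℚₚ.*-monoʳ-≤-nonNeg ∣ q ℚ.- p ∣ {{ℚₚ.∣-∣-nonNeg (q ℚ.- p)}}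
        (*-mono-≤ (ℚₚ.<⇒≤ (recip>0 p)) (ℚₚ.<⇒≤ (recip>0 ε)) (recip≤E p ε≤p) (recip≤E q ε≤q)))
      where
      r = recip p
      s = recip q
      rs≥0 : 0ℚ ℚ.≤ r ℚ.* s
      rs≥0 = ℚₚ.<⇒≤ (ℚₚ.positive⁻¹ _
        {{ℚₚ.pos*pos⇒pos r {{ℚ.positive (recip>0 p)}} s {{ℚ.positive (recip>0 q)}}}})
      diff : (r ℚ.* s) ℚ.* (q ℚ.- p) ≡ r ℚ.- s
      diff = trans (inv-shuffle r s p q) (cong₂ ℚ._-_
        (trans (cong (r ℚ.*_) (recip-inv q ε≤q)) (ℚₚ.*-identityʳ r))
        (trans (cong (s ℚ.*_) (recip-inv p ε≤p)) (ℚₚ.*-identityʳ s)))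
      eq : (r ℚ.* s) ℚ.* ∣ q ℚ.- p ∣ ≡ ∣ r ℚ.- s ∣
      eq = trans (cong (ℚ._* ∣ q ℚ.- p ∣) (sym (ℚₚ.0≤p⇒∣p∣≡p rs≥0)))
        (trans (sym (ℚₚ.∣p*q∣≡∣p∣*∣q∣ (r ℚ.* s) (q ℚ.- p))) (cong ∣_∣ diff))

    recip-cauchy : ∀ {s} → SeqCauchy s → (∃ λ N → ∀ n → N ℕ.≤ n → ε ℚ.≤ s n) →
                   SeqCauchy (recip ∘ s)
    recip-cauchy {s} cs (M , ε≤s) η η>0 =
      let δ , δ>0 , EEδ = scale (E ℚ.* E) η EE>0 η>0
          N , h = cs δ δ>0
      in M ℕ.⊔ N , λ m n Lm Ln →
        ℚₚ.≤-<-trans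
          (recip-diff (s m) (s n) (ε≤s m (≤⊔ˡ {M} {N} Lm)) (ε≤s n (≤⊔ˡ {M} {N} Ln)))
          (subst ((E ℚ.* E) ℚ.* ∣ s n ℚ.- s m ∣ ℚ.<_) EEδ
            (ℚₚ.*-monoʳ-<-pos (E ℚ.* E) {{ℚ.positive EE>0}}
              (h n m (≤⊔ʳ {M} {N} Ln) (≤⊔ʳ {M} {N} Lm))))
      where
      EE>0 : 0ℚ ℚ.< E ℚ.* E
      EE>0 = ℚₚ.positive⁻¹ _
        {{ℚₚ.pos*pos⇒pos E {{ℚ.positive (recip>0 ε)}} E {{ℚ.positive (recip>0 ε)}}}}

open CauchyLemmas

record ℝ : Set where
  constructor mkℝ
  field
    seq    : ℕ → ℚ
    cauchy : SeqCauchy seq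

open ℝ public

infix  4 _<ᴿ_ _≤ᴿ_ _≃ᴿ_
infixl 6 _+ᴿ_ _-ᴿ_
infixl 7 _*ᴿ_

fromℚ : ℚ → ℝ
fromℚ p = mkℝ (λ _ → p) λ ε ε>0 →
  0 , λ _ _ _ _ → subst (λ t → ∣ t ∣ ℚ.< ε) (sym (ℚₚ.+-inverseʳ p)) ε>0

fromℤ : ℤ → ℝ
fromℤ k = fromℚ (k ℚ./ 1)

fromℕ : ℕ → ℝ
fromℕ n = fromℤ (+ n)

0ᴿ 1ᴿ : ℝ
0ᴿ = fromℕ 0
1ᴿ = fromℕ 1

_<ᴿ_ _≤ᴿ_ _≃ᴿ_ : ℝ → ℝ → Set
x <ᴿ y = ∃ λ ε → 0ℚ ℚ.< ε × ∃ λ N → ∀ n → N ℕ.≤ n → seq x n ℚ.+ ε ℚ.≤ seq y n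
x ≤ᴿ y = ∀ ε → 0ℚ ℚ.< ε → ∃ λ N → ∀ n → N ℕ.≤ n → seq x n ℚ.≤ seq y n ℚ.+ ε
x ≃ᴿ y = x ≤ᴿ y × y ≤ᴿ x

_+ᴿ_ _-ᴿ_ _*ᴿ_ : ℝ → ℝ → ℝ
x +ᴿ y = mkℝ (λ n → seq x n ℚ.+ seq y n) (+-cauchy {seq x} {seq y} (cauchy x) (cauchy y))
x -ᴿ y = mkℝ (λ n → seq x n ℚ.- seq y n) (+-cauchy {seq x} {λ n → ℚ.- seq y n} (cauchy x) (neg-cauchy {seq y} (cauchy y)))
x *ᴿ y = mkℝ (λ n → seq x n ℚ.* seq y n) (*-cauchy {seq x} {seq y} (cauchy x) (cauchy y))

-- The maximum with the positive lower bound ε of the tail of x only makes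
-- the finitely many initial terms invertible.
inv : (x : ℝ) → 0ᴿ <ᴿ x → ℝ
inv x (ε , ε>0 , N , h) = mkℝ (recip ∘ seq x)
  (recip-cauchy {seq x} (cauchy x)
    (N , λ n N≤n → subst (ℚ._≤ seq x n) (ℚₚ.+-identityˡ ε) (h n N≤n)))
  where open Recip ε ε>0

divide : (x y : ℝ) → 0ᴿ <ᴿ y → ℝ
divide x y y>0 = x *ᴿ inv y y>0

syntax divide x y y>0 = x ÷ᴿ y [ y>0 ]

-- A relation, as the floor of a Cauchy real is not computable in general.
IsFloor : ℝ → ℤ → Set
IsFloor x k = fromℤ k ≤ᴿ x × x <ᴿ fromℤ (k ℤ.+ + 1)

-- log m = ∫₁ᵐ dt/t.  With N = j + 1, term j of the sequence is the Riemann
-- sum of 1/t over [1 , m] for the mesh 1/N, namely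
--   Σ_{i < (m-1)N} (1/N) · 1/(1 + i/N)  =  Σ_{i < (m-1)N} 1/(N + i).
-- The value at m = 0 is the junk value 0.
logSeq : ℕ → ℕ → ℚ
logSeq m j = ∑ ((m ℕ.∸ 1) ℕ.* suc j) (λ i → + 1 ℚ./ (suc j ℕ.+ i))

module LogLemmas where
  u : ℕ → ℚ
  u k = + 1 ℚ./ suc k

  toℚᵘ-u : ∀ k → ℚ.toℚᵘ (u k) ℚᵘ.≃ ℚᵘ.mkℚᵘ (+ 1) k
  toℚᵘ-u k = ℚₚ.toℚᵘ-fromℚᵘ (ℚᵘ.mkℚᵘ (+ 1) k)

  u-anti : ∀ {k l} → k ℕ.≤ l → u l ℚ.≤ u k
  u-anti {k} {l} k≤l = ℚₚ.toℚᵘ-cancel-≤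
    (ℚᵘₚ.≤-respˡ-≃ (ℚᵘₚ.≃-sym (toℚᵘ-u l)) (ℚᵘₚ.≤-respʳ-≃ (ℚᵘₚ.≃-sym (toℚᵘ-u k))
      (ℚᵘ.*≤* (ℤ.+≤+ (ℕₚ.*-monoʳ-≤ 1 (s≤s k≤l))))))

  u>0 : ∀ k → 0ℚ ℚ.< u k
  u>0 k = ℚₚ.positive⁻¹ (u k) {{ℚₚ.normalize-pos 1 (suc k)}}

  u≥0 : ∀ k → 0ℚ ℚ.≤ u k
  u≥0 k = ℚₚ.<⇒≤ (u>0 k)

  u-small : ∀ ε → 0ℚ ℚ.< ε → ∃ λ N → ∀ n → N ℕ.≤ n → u n ℚ.< ε
  u-small ε ε>0 = go ε (ℚ.positive ε>0)
    where
    go : ∀ ε → ℚ.Positive ε → ∃ λ N → ∀ n → N ℕ.≤ n → u n ℚ.< ε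
    go ε@(mkℚ (ℤ.+[1+ k ]) d _) _ = suc d , λ n d<n → ℚₚ.toℚᵘ-cancel-<
      (ℚᵘₚ.<-respˡ-≃ (ℚᵘₚ.≃-sym (toℚᵘ-u n))
        (ℚᵘ.*<* (ℤ.+<+ (ℕₚ.<-≤-trans
          (subst (ℕ._< suc n) (sym (ℕₚ.+-identityʳ (suc d))) (s≤s d<n))
          (ℕₚ.m≤m+n (suc n) (k ℕ.* suc n))))))

  ∑-nonneg : ∀ n f → (∀ i → 0ℚ ℚ.≤ f i) → 0ℚ ℚ.≤ ∑ n f
  ∑-nonneg zero    f h = ℚₚ.≤-refl
  ∑-nonneg (suc n) f h = ℚₚ.+-mono-≤ (h 0) (∑-nonneg n (f ∘ suc) (h ∘ suc))

  ∑-mono : ∀ n f g → (∀ i → i ℕ.< n → f i ℚ.≤ g i) → ∑ n f ℚ.≤ ∑ n g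
  ∑-mono zero    f g h = ℚₚ.≤-refl
  ∑-mono (suc n) f g h = ℚₚ.+-mono-≤ (h 0 (s≤s z≤n))
    (∑-mono n (f ∘ suc) (g ∘ suc) (λ i i<n → h (suc i) (s≤s i<n)))

  ∑-cong : ∀ n {f g} → (∀ i → f i ≡ g i) → ∑ n f ≡ ∑ n g
  ∑-cong zero    h = refl
  ∑-cong (suc n) h = cong₂ ℚ._+_ (h 0) (∑-cong n (h ∘ suc))

  ∑-split : ∀ m n f → ∑ (m ℕ.+ n) f ≡ ∑ m f ℚ.+ ∑ n (λ i → f (m ℕ.+ i))
  ∑-split zero    n f = sym (ℚₚ.+-identityˡ _)
  ∑-split (suc m) n f = trans (cong (f 0 ℚ.+_) (∑-split m n (f ∘ suc)))
    (sym (ℚₚ.+-assoc (f 0) _ _))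

  ∑-shift : ∀ n f → (∀ i → 0ℚ ℚ.≤ f i) → ∑ n f ℚ.≤ f 0 ℚ.+ ∑ n (f ∘ suc)
  ∑-shift zero    f h = subst (0ℚ ℚ.≤_) (sym (ℚₚ.+-identityʳ (f 0))) (h 0)
  ∑-shift (suc n) f h = ℚₚ.+-monoʳ-≤ (f 0) (∑-shift n (f ∘ suc) (h ∘ suc))

  ∑-blocks-≤ : ∀ A M g f → (∀ i → ∑ M (λ j → g (i ℕ.* M ℕ.+ j)) ℚ.≤ f i) →
               ∑ (A ℕ.* M) g ℚ.≤ ∑ A f
  ∑-blocks-≤ zero    M g f h = ℚₚ.≤-refl
  ∑-blocks-≤ (suc A) M g f h =
    subst (ℚ._≤ ∑ (suc A) f) (sym (∑-split M (A ℕ.* M) g))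
      (ℚₚ.+-mono-≤ (h 0) (∑-blocks-≤ A M (λ i → g (M ℕ.+ i)) (f ∘ suc) λ i →
        subst (ℚ._≤ f (suc i)) (∑-cong M (λ j → cong g (ℕₚ.+-assoc M (i ℕ.* M) j)))
          (h (suc i))))

  ∑-blocks-≥ : ∀ A M g f → (∀ i → f i ℚ.≤ ∑ M (λ j → g (i ℕ.* M ℕ.+ j))) →
               ∑ A f ℚ.≤ ∑ (A ℕ.* M) g
  ∑-blocks-≥ zero    M g f h = ℚₚ.≤-refl
  ∑-blocks-≥ (suc A) M g f h =
    subst (∑ (suc A) f ℚ.≤_) (sym (∑-split M (A ℕ.* M) g))
      (ℚₚ.+-mono-≤ (h 0) (∑-blocks-≥ A M (λ i → g (M ℕ.+ i)) (f ∘ suc) λ i →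
        subst (f (suc i) ℚ.≤_) (∑-cong M (λ j → cong g (ℕₚ.+-assoc M (i ℕ.* M) j)))
          (h (suc i))))

  ∑-const : ∀ n p → ∑ n (λ _ → p) ≡ (+ n ℚ./ 1) ℚ.* p
  ∑-const zero    p = sym (ℚₚ.*-zeroˡ p)
  ∑-const (suc n) p = trans (cong₂ ℚ._+_ (sym (ℚₚ.*-identityˡ p)) (∑-const n p))
    (trans (sym (ℚₚ.*-distribʳ-+ p 1ℚ (+ n ℚ./ 1))) (cong (ℚ._* p) suc-homo))
    where
    open ℚᵘₚ.≃-Reasoning
    suc-homo : 1ℚ ℚ.+ (+ n ℚ./ 1) ≡ + suc n ℚ./ 1
    suc-homo = ℚₚ.toℚᵘ-injective (begin
      ℚ.toℚᵘ (1ℚ ℚ.+ (+ n ℚ./ 1))           ≈⟨ ℚₚ.toℚᵘ-homo-+ 1ℚ (+ n ℚ./ 1) ⟩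
      ℚᵘ.1ℚᵘ ℚᵘ.+ ℚ.toℚᵘ (+ n ℚ./ 1)        ≈⟨ ℚᵘₚ.+-congʳ ℚᵘ.1ℚᵘ (ℚₚ.toℚᵘ-fromℚᵘ (ℚᵘ.mkℚᵘ (+ n) 0)) ⟩
      ℚᵘ.1ℚᵘ ℚᵘ.+ ℚᵘ.mkℚᵘ (+ n) 0           ≈⟨ ℚᵘ.*≡* (cong (λ k → (+ 1 ℤ.+ k) ℤ.* + 1) (ℤₚ.*-identityʳ (+ n))) ⟩
      ℚᵘ.mkℚᵘ (+ suc n) 0                   ≈⟨ ℚᵘₚ.≃-sym (ℚₚ.toℚᵘ-fromℚᵘ (ℚᵘ.mkℚᵘ (+ suc n) 0)) ⟩
      ℚ.toℚᵘ (+ suc n ℚ./ 1)                ∎)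

  ∑-u : ∀ M a b → suc a ≡ suc M ℕ.* suc b → ∑ (suc M) (λ _ → u a) ≡ u b
  ∑-u M a b eq = trans (∑-const (suc M) (u a)) (ℚₚ.toℚᵘ-injective (begin
    ℚ.toℚᵘ ((+ suc M ℚ./ 1) ℚ.* u a)              ≈⟨ ℚₚ.toℚᵘ-homo-* (+ suc M ℚ./ 1) (u a) ⟩
    ℚ.toℚᵘ (+ suc M ℚ./ 1) ℚᵘ.* ℚ.toℚᵘ (u a)      ≈⟨ ℚᵘₚ.*-cong (ℚₚ.toℚᵘ-fromℚᵘ (ℚᵘ.mkℚᵘ (+ suc M) 0)) (toℚᵘ-u a) ⟩
    ℚᵘ.mkℚᵘ (+ suc M) 0 ℚᵘ.* ℚᵘ.mkℚᵘ (+ 1) a      ≈⟨ ℚᵘ.*≡* (cong +_ nat) ⟩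
    ℚᵘ.mkℚᵘ (+ 1) b                               ≈⟨ ℚᵘₚ.≃-sym (toℚᵘ-u b) ⟩
    ℚ.toℚᵘ (u b)                                  ∎))
    where
    open ℚᵘₚ.≃-Reasoning
    nat : suc M ℕ.* 1 ℕ.* suc b ≡ 1 ℕ.* (1 ℕ.* suc a)
    nat = trans (cong (ℕ._* suc b) (ℕₚ.*-identityʳ (suc M)))
      (trans (sym eq) (sym (trans (ℕₚ.*-identityˡ _) (ℕₚ.*-identityˡ _))))

  lower : ℕ → ℕ → ℚ
  lower m j = ∑ ((m ℕ.∸ 1) ℕ.* suc j) (λ i → u (suc (j ℕ.+ i)))

  lower≤log : ∀ m j → lower m j ℚ.≤ logSeq m j
  lower≤log m j = ∑-mono ((m ℕ.∸ 1) ℕ.* suc j)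
    (λ i → u (suc (j ℕ.+ i))) (λ i → u (j ℕ.+ i)) (λ i _ → u-anti (ℕₚ.n≤1+n (j ℕ.+ i)))

  log≤lower : ∀ m j → logSeq m j ℚ.≤ u j ℚ.+ lower m j
  log≤lower m j = subst₂ (λ a b → logSeq m j ℚ.≤ a ℚ.+ b)
    (cong u (ℕₚ.+-identityʳ j))
    (∑-cong ((m ℕ.∸ 1) ℕ.* suc j) (λ i → cong u (ℕₚ.+-suc j i)))
    (∑-shift ((m ℕ.∸ 1) ℕ.* suc j) (λ i → u (j ℕ.+ i)) (λ i → u≥0 (j ℕ.+ i)))

  common : ℕ → ℕ → ℕ
  common j k = k ℕ.+ j ℕ.* suc k

  log-refine : ∀ m j k → logSeq m (common j k) ℚ.≤ logSeq m j
  log-refine m j k = subst (λ l → ∑ l (λ i → u (p ℕ.+ i)) ℚ.≤ logSeq m j)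
    (ℕₚ.*-assoc (m ℕ.∸ 1) (suc j) (suc k))
    (∑-blocks-≤ ((m ℕ.∸ 1) ℕ.* suc j) (suc k) (λ i → u (p ℕ.+ i)) (λ i → u (j ℕ.+ i)) λ i →
      ℚₚ.≤-trans
        (∑-mono (suc k) _ (λ _ → u (p ℕ.+ i ℕ.* suc k)) (λ l _ →
          u-anti (ℕₚ.+-monoʳ-≤ p (ℕₚ.m≤m+n (i ℕ.* suc k) l))))
        (ℚₚ.≤-reflexive (∑-u k (p ℕ.+ i ℕ.* suc k) (j ℕ.+ i) (nat i))))
    where
    p = common j k
    nat : ∀ i → suc (p ℕ.+ i ℕ.* suc k) ≡ suc k ℕ.* suc (j ℕ.+ i)
    nat i = solve 3 (λ j k i →
      con 1 :+ ((k :+ j :* (con 1 :+ k)) :+ i :* (con 1 :+ k))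
        := (con 1 :+ k) :* (con 1 :+ (j :+ i))) refl j k i
      where open ℕ-Solver

  lower-refine : ∀ m j k → lower m j ℚ.≤ lower m (common j k)
  lower-refine m j k = subst (λ l → lower m j ℚ.≤ ∑ l (λ i → u (suc (p ℕ.+ i))))
    (ℕₚ.*-assoc (m ℕ.∸ 1) (suc j) (suc k))
    (∑-blocks-≥ ((m ℕ.∸ 1) ℕ.* suc j) (suc k) (λ i → u (suc (p ℕ.+ i)))
      (λ i → u (suc (j ℕ.+ i))) λ i →
      ℚₚ.≤-trans
        (ℚₚ.≤-reflexive (sym (∑-u k (p ℕ.+ (i ℕ.* suc k ℕ.+ suc k)) (suc (j ℕ.+ i)) (nat i))))
        (∑-mono (suc k) (λ _ → u (p ℕ.+ (i ℕ.* suc k ℕ.+ suc k))) _ (λ l l<k →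
          u-anti (subst (ℕ._≤ p ℕ.+ (i ℕ.* suc k ℕ.+ suc k)) (ℕₚ.+-suc p (i ℕ.* suc k ℕ.+ l))
            (ℕₚ.+-monoʳ-≤ p (subst (ℕ._≤ i ℕ.* suc k ℕ.+ suc k) (ℕₚ.+-suc (i ℕ.* suc k) l)
              (ℕₚ.+-monoʳ-≤ (i ℕ.* suc k) l<k)))))))
    where
    p = common j k
    nat : ∀ i → suc (p ℕ.+ (i ℕ.* suc k ℕ.+ suc k)) ≡ suc k ℕ.* suc (suc (j ℕ.+ i))
    nat i = solve 3 (λ j k i →
      con 1 :+ ((k :+ j :* (con 1 :+ k)) :+ (i :* (con 1 :+ k) :+ (con 1 :+ k)))
        := (con 1 :+ k) :* (con 1 :+ (con 1 :+ (j :+ i)))) refl j k i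
      where open ℕ-Solver

  common-comm : ∀ j k → common j k ≡ common k j
  common-comm = solve 2 (λ j k →
    k :+ j :* (con 1 :+ k) := j :+ k :* (con 1 :+ j)) refl
    where open ℕ-Solver

  log-diff : ∀ m a b → logSeq m a ℚ.- logSeq m b ℚ.≤ u a
  log-diff m a b = subst (logSeq m a ℚ.- logSeq m b ℚ.≤_) (sub-cancel (u a) (logSeq m b))
    (ℚₚ.+-monoˡ-≤ (ℚ.- logSeq m b)
      (ℚₚ.≤-trans (log≤lower m a) (ℚₚ.+-monoʳ-≤ (u a)
        (ℚₚ.≤-trans (lower-refine m a b)
          (ℚₚ.≤-trans (lower≤log m (common a b))
            (subst (λ p → logSeq m p ℚ.≤ logSeq m b) (common-comm b a) (log-refine m b a)))))))

  neg-sub : ∀ a b → b ℚ.- a ≡ ℚ.- (a ℚ.- b)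
  neg-sub = solve 2 (λ a b → b :- a := :- (a :- b)) refl
    where open ℚ-Solver

  ∣-∣-< : ∀ a b ε → a ℚ.- b ℚ.< ε → b ℚ.- a ℚ.< ε → ∣ a ℚ.- b ∣ ℚ.< ε
  ∣-∣-< a b ε a-b<ε b-a<ε with ℚₚ.∣p∣≡p∨∣p∣≡-p (a ℚ.- b)
  ... | inj₁ eq = subst (ℚ._< ε) (sym eq) a-b<ε
  ... | inj₂ eq = subst (ℚ._< ε) (trans (neg-sub a b) (sym eq)) b-a<ε

  log-cauchy : ∀ m → SeqCauchy (logSeq m)
  log-cauchy m ε ε>0 = let N , h = u-small ε ε>0 in
    N , λ a b Na Nb → ∣-∣-< (logSeq m a) (logSeq m b) ε
      (ℚₚ.≤-<-trans (log-diff m a b) (h a Na))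
      (ℚₚ.≤-<-trans (log-diff m b a) (h b Nb))

open LogLemmas

log : ℕ → ℝ
log m = mkℝ (logSeq m) (log-cauchy m)

module BoundLemmas where
  log≥½ : ∀ {m} → 2 ℕ.≤ m → ∀ j → ½ ℚ.≤ logSeq m j
  log≥½ {m@(suc (suc k))} _ j = ℚₚ.≤-trans
    (subst (ℚ._≤ lower m 0) (ℚₚ.+-identityʳ ½)
      (ℚₚ.+-monoʳ-≤ ½ (∑-nonneg (k ℕ.* 1) (λ i → u (suc (suc i))) (λ i → u≥0 (suc (suc i))))))
    (ℚₚ.≤-trans
      (subst (λ p → lower m 0 ℚ.≤ lower m p) (ℕₚ.+-identityʳ j) (lower-refine m 0 j))
      (lower≤log m j))
  log≥½ {suc zero} (s≤s ()) j

  log≥0 : ∀ m j → 0ℚ ℚ.≤ logSeq m j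
  log≥0 m j = ∑-nonneg ((m ℕ.∸ 1) ℕ.* suc j) (λ i → u (j ℕ.+ i)) (λ i → u≥0 (j ℕ.+ i))

  2≤q! : ∀ {q} → 2 ℕ.≤ q → 2 ℕ.≤ q !
  2≤q! {q} 2≤q = ℕₚ.≤-trans 2≤q (n≤n! q)
    where
    n≤n! : ∀ n → n ℕ.≤ n !
    n≤n! zero    = z≤n
    n≤n! (suc n) = ℕₚ.m≤m*n (suc n) (n !) {{ℕ.>-nonZero (ℕₚ.1≤n! n)}}

open BoundLemmas

inv-^ : (q n : ℕ) → .{{ℕ.NonZero q}} → ℚ
inv-^ q n = (+ 1 ℚ./ (q ℕ.^ n)) {{ℕₚ.m^n≢0 q n}}

numer : ℕ → ℕ → ℝ
numer q n = fromℕ n *ᴿ log q -ᴿ 1ᴿ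

denom : (q n : ℕ) → .{{ℕ.NonZero q}} → ℝ
denom q n = fromℚ (+ 1 ℚ./ q) *ᴿ log (q !) +ᴿ fromℚ (inv-^ q n) *ᴿ log n

denom>0 : ∀ q n .{{_ : ℕ.NonZero q}} → 2 ℕ.≤ q → 0ᴿ <ᴿ denom q n
denom>0 q n 2≤q =
  (+ 1 ℚ./ q) ℚ.* ½ , ℚₚ.positive⁻¹ _ {{ℚₚ.pos*pos⇒pos (+ 1 ℚ./ q) {{1/q⁺}} ½}} , 0 , λ j _ →
  subst (ℚ._≤ seq (denom q n) j) (ℚₚ.+-comm ((+ 1 ℚ./ q) ℚ.* ½) 0ℚ)
    (ℚₚ.+-mono-≤
      (ℚₚ.*-monoˡ-≤-nonNeg (+ 1 ℚ./ q) {{ℚₚ.pos⇒nonNeg (+ 1 ℚ./ q) {{1/q⁺}}}}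
        (log≥½ (2≤q! 2≤q) j))
      (ℚₚ.nonNegative⁻¹ _ {{ℚₚ.nonNeg*nonNeg⇒nonNeg
        (inv-^ q n) {{ℚₚ.normalize-nonNeg 1 (q ℕ.^ n) {{ℕₚ.m^n≢0 q n}}}}
        (logSeq n j) {{ℚ.nonNegative (log≥0 n j)}}}}))
  where
  1/q⁺ = ℚₚ.normalize-pos 1 q

bound : (q n : ℕ) → 2 ℕ.≤ q → ℝ
bound q n 2≤q = numer q n ÷ᴿ denom q n [ denom>0 q n 2≤q ]
  where
  instance
    q≢0 : ℕ.NonZero q
    q≢0 = ℕ.>-nonZero (ℕₚ.<⇒≤ 2≤q)

Transformation : Set → ℕ → Set
Transformation A n = Vec A n → Vec A n

Permutation : Set → ℕ → Set
Permutation A n = Vec A n ↔ Vec A n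

coordinate : ∀ {A n} → Transformation A n → Fin n → Vec A n → A
coordinate f i x = lookup (f x) i

Trivial : ∀ {A n} → Transformation A n → Fin n → Set
Trivial f i = ∀ x → coordinate f i x ≡ lookup x i

IsInstruction : ∀ {A n} → Transformation A n → Set
IsInstruction f = ∀ i j → ¬ Trivial f i → ¬ Trivial f j → i ≡ j

Instruction : Set → ℕ → Set
Instruction A n = Σ (Transformation A n) IsInstruction

Program : Set → ℕ → Set
Program A n = List (Instruction A n)

-- The head of the list is the first instruction applied.
⟦_⟧ : ∀ {A n} → Program A n → Transformation A n
⟦ []    ⟧ = id
⟦ g ∷ p ⟧ = ⟦ p ⟧ ∘ proj₁ g

_Computes_ : ∀ {A n} → Program A n → Transformation A n → Set
p Computes f = ∀ x → ⟦ p ⟧ x ≡ f x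

-- The relation 𝓛(f) = L.
ProceduralComplexity : ∀ {A n} → Transformation A n → ℕ → Set
ProceduralComplexity f L =
  (∃ λ p → p Computes f × length p ≡ L) ×
  (∀ p → p Computes f → L ℕ.≤ length p)

ComplexityAtLeast : ∀ {A n} → ℤ → Transformation A n → Set
ComplexityAtLeast k f = ∀ L → ProceduralComplexity f L → k ℤ.≤ + L

-- Permutations are identified when they agree pointwise; the proofs of P are
-- ignored.
permutationsWith : ∀ A n → (Transformation A n → Set) → Setoid _ _
permutationsWith A n P = On.setoid (Vec A n →-setoid Vec A n) to
  where
  to : Σ (Permutation A n) (P ∘ Inverse.to) → Transformation A n
  to = Inverse.to ∘ proj₁

HasCardinality : ∀ {a ℓ} → Setoid a ℓ → ℕ → Set _
HasCardinality S c = Inverse (setoid (Fin c)) S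

proportion : (q n c : ℕ) → ℚ
proportion q n c = (+ c ℚ./ ((q ℕ.^ n) !)) {{(q ℕ.^ n) ℕₚ.!≢0}}

{-# OPTIONS --safe #-}

-- A program computing a permutation consists of bijective instructions, of which there are at most
-- M = n (q!)^(q^(n-1)).  Padding with the identity, at most M^k permutations have complexity ≤ k.
-- With N = q^n and k at most the bound, k log M ≤ N log N - N.  From m = 1 on, the inequality
--   (5m + 1)(log(m+1) - log m) ≤ 5
-- yields (5N + 1) log N ≤ 5 log N! + 5N by induction, so that (M^k)^5 N ≤ (N!)^5
-- and M^k / N! tends to 0.
module Submission where

open import Defs
open CauchyLemmas using (half>0; half+half; scale; bounded; add-sub; ≤⊔ˡ; ≤⊔ʳ; module Recip)
open LogLemmas
open import Data.Fin.Base using (Fin; zero; suc; punchIn; punchOut; combine; remQuot; splitAt; join; finToFun; funToFin)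
import Data.Fin.Permutation as Perm
import Data.Fin.Properties as Finₚ
open import Data.Integer.Base as ℤ using (ℤ; +_; -[1+_])
import Data.Integer.Properties as ℤₚ
open import Data.List.Base using ([]; _∷_; length)
open import Data.Nat.Base as ℕ using (ℕ; zero; suc; _≤_; _!; z≤n; s≤s; NonZero)
import Data.Nat.Properties as ℕₚ
open import Data.Nat.Solver renaming (module +-*-Solver to ℕ-Solver)
open import Data.Product.Base using (∃; _×_; _,_; proj₁; proj₂; uncurry)
open import Data.Rational.Base as ℚ using (ℚ; 0ℚ; 1ℚ; ½; ∣_∣)
import Data.Rational.Properties as ℚₚ
open import Data.Rational.Solver renaming (module +-*-Solver to ℚ-Solver)
import Data.Rational.Unnormalised.Base as ℚᵘ
import Data.Rational.Unnormalised.Properties as ℚᵘₚ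
open import Data.Sum.Base using (_⊎_; inj₁; inj₂)
import Data.Sum.Properties as Sumₚ
open import Data.Vec.Base using (Vec; []; _∷_; lookup; insertAt; removeAt)
import Data.Vec.Properties as Vecₚ
open import Data.Vec.Relation.Binary.Pointwise.Extensional using (ext; Pointwise-≡⇒≡)
open import Function.Base using (_∘_; id)
open import Function.Bundles using (Inverse; Injection; _↔_; mk↔ₛ′)
open import Function.Definitions using (Injective)
open import Function.Properties.Inverse using (↔⇒↣)
open import Relation.Binary.PropositionalEquality
  using (_≡_; _≢_; _≗_; refl; sym; trans; cong; cong₂; subst; subst₂; module ≡-Reasoning)
import Relation.Binary.Reasoning.Base.Single as SingleReasoning
open import Relation.Nullary using (Dec; yes; no; ¬_; contradiction; ¬?)
open import Relation.Nullary.Decidable using (map′; decidable-stable)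

-- The estimate log N! ≥ N log N - N alone would give only M^k ≤ N!, which says nothing about the
-- limit, so a surplus proportional to log N is needed. For a surplus c log N the induction asks for
-- (m + c)(log(m+1) - log m) ≤ 1. Bounding the difference of logarithms by the upper sum with a
-- single cell, 1/m, allows no c above 0. Two cells give 1/(2m) + 1/(2m+1) and allow c up to
-- m/(4m+1), whose least value, at m = 1, is 1/5; this is the source of the 5. Clearing that
-- denominator makes all exponents integers, so the estimate can leave the real numbers: strict
-- growth of log on the natural numbers takes the place of the exponential, and a comparison of
-- fifth powers that of the root. Logarithms are Cauchy sequences of Riemann sums, and identities
-- such as log(ab) = log a + log b hold between sums on different meshes. Inequalities are therefore
-- handled up to an eventual tolerance.

-- Injections and permutations of finite sets

injective⇒surjective : ∀ {n} {f : Fin n → Fin n} → Injective _≡_ _≡_ f →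
                       ∀ y → ∃ λ x → f x ≡ y
injective⇒surjective {suc n} {f} inj y with Finₚ.any? (λ x → f x Finₚ.≟ y)
... | yes p = p
-- Punching out the missed value `y` would inject `Fin (suc n)` into `Fin n`.
... | no ¬p = contradiction
  (Finₚ.injective⇒≤ {f = λ x → punchOut (avoids x)}
    (λ {x} {x′} → inj ∘ Finₚ.punchOut-injective (avoids x) (avoids x′)))
  ℕₚ.1+n≰n
  where
  avoids : ∀ x → y ≢ f x
  avoids x y≡fx = ¬p (x , sym y≡fx)

-- The recursion follows (n+1)! = (n+1) n!: the image of zero is the leading digit, and the
-- permutation induced on the rest supplies the others. The digits form the Lehmer code, so this is
-- the lexicographic rank.
rank : ∀ {n} → Perm.Permutation n n → Fin (n !)
rank {zero}  π = zero
rank {suc n} π = combine (π Perm.⟨$⟩ʳ zero) (rank (Perm.remove zero π))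

unrank : ∀ {n} → Fin (n !) → Perm.Permutation n n
unrank {zero}  i = Perm.id
unrank {suc n} i = Perm.insert zero (proj₁ (remQuot {suc n} (n !) i)) (unrank (proj₂ (remQuot {suc n} (n !) i)))

insert-cong : ∀ {n} {a b : Fin (suc n)} {π ρ : Perm.Permutation n n} → a ≡ b → π Perm.≈ ρ →
              Perm.insert zero a π Perm.≈ Perm.insert zero b ρ
insert-cong a≡b π≈ρ zero    = a≡b
insert-cong a≡b π≈ρ (suc k) = cong₂ punchIn a≡b (π≈ρ k)

-- The values of `remove` come from `punchOut` with a proof that mentions the permutation, so they
-- are compared after applying the injective `punchIn` at the image of zero.
remove-cong : ∀ {n} {π ρ : Perm.Permutation (suc n) (suc n)} → π Perm.≈ ρ →
              Perm.remove zero π Perm.≈ Perm.remove zero ρ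
remove-cong {n} {π} {ρ} π≈ρ k = Finₚ.punchIn-injective (ρ Perm.⟨$⟩ʳ zero) _ _
  (trans (cong (λ i → punchIn i (Perm.remove zero π Perm.⟨$⟩ʳ k)) (sym (π≈ρ zero)))
    (trans (sym (Perm.punchIn-permute π zero k))
      (trans (π≈ρ (suc k)) (Perm.punchIn-permute ρ zero k))))

rank-cong : ∀ {n} {π ρ : Perm.Permutation n n} → π Perm.≈ ρ → rank π ≡ rank ρ
rank-cong {zero}          π≈ρ = refl
rank-cong {suc n} {π} {ρ} π≈ρ = cong₂ combine (π≈ρ zero) (rank-cong (remove-cong {π = π} {ρ} π≈ρ))

unrank-rank : ∀ {n} (π : Perm.Permutation n n) → unrank (rank π) Perm.≈ π
unrank-rank {suc n} π i = trans
  (insert-cong (cong proj₁ split)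
    (λ k → trans (cong (λ s → unrank (proj₂ s) Perm.⟨$⟩ʳ k) split) (unrank-rank (Perm.remove zero π) k)) i)
  (Perm.insert-remove zero π i)
  where
  split = Finₚ.remQuot-combine (π Perm.⟨$⟩ʳ zero) (rank (Perm.remove zero π))

rank-unrank : ∀ {n} (i : Fin (n !)) → rank (unrank {n} i) ≡ i
rank-unrank {zero}  zero = refl
rank-unrank {suc n} i = trans
  (cong (combine (proj₁ s)) (trans
    (rank-cong (Perm.remove-insert zero (proj₁ s) (unrank (proj₂ s))))
    (rank-unrank {n} (proj₂ s))))
  (Finₚ.combine-remQuot {suc n} (n !) i)
  where
  s = remQuot {suc n} (n !) i

module Finite {X : Set} {m : ℕ} (X↔Fin : X ↔ Fin m) where
  open Inverse X↔Fin public
    using () renaming (to to index; from to element; strictlyInverseˡ to index-element; strictlyInverseʳ to element-index)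

  index-injective : Injective _≡_ _≡_ index
  index-injective = Injection.injective (↔⇒↣ X↔Fin)

  element-injective : Injective _≡_ _≡_ element
  element-injective {i} {j} eq = trans (sym (index-element i)) (trans (cong index eq) (index-element j))

  _≟_ : (x y : X) → Dec (x ≡ y)
  x ≟ y = map′ index-injective (cong index) (index x Finₚ.≟ index y)

  ∀? : {P : X → Set} → (∀ x → Dec (P x)) → Dec (∀ x → P x)
  ∀? {P} P? = map′ (λ h x → subst P (element-index x) (h (index x))) (_∘ element)
    (Finₚ.all? (P? ∘ element))

  module _ {f : X → X} (inj : Injective _≡_ _≡_ f) where
    surjective : ∀ y → ∃ λ x → f x ≡ y
    surjective y with injective⇒surjective {f = index ∘ f ∘ element}
                        (element-injective ∘ inj ∘ index-injective) (index y)
    ... | i , eq = element i , index-injective eq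

    bijection : X ↔ X
    bijection = mk↔ₛ′ f (proj₁ ∘ surjective) (proj₂ ∘ surjective)
      (λ x → inj (proj₂ (surjective (f x))))

  arrangement : Fin (m !) → X ↔ X
  arrangement i = mk↔ₛ′
    (λ x → element (unrank i Perm.⟨$⟩ʳ index x))
    (λ x → element (unrank i Perm.⟨$⟩ˡ index x))
    (λ x → trans (cong element (trans (cong (unrank i Perm.⟨$⟩ʳ_) (index-element _))
      (Perm.inverseʳ (unrank i)))) (element-index x))
    (λ x → trans (cong element (trans (cong (unrank i Perm.⟨$⟩ˡ_) (index-element _))
      (Perm.inverseˡ (unrank i)))) (element-index x))

  arrange : Fin (m !) → X → X
  arrange = Inverse.to ∘ arrangement

  arrange-injective : ∀ {i j} → arrange i ≗ arrange j → i ≡ j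
  arrange-injective {i} {j} eq = trans (sym (rank-unrank {m} i))
    (trans (rank-cong λ k → trans (cong (unrank i Perm.⟨$⟩ʳ_) (sym (index-element k)))
       (trans (element-injective (eq (element k))) (cong (unrank j Perm.⟨$⟩ʳ_) (index-element k))))
     (rank-unrank {m} j))

  arrange-covers : ∀ {f} → Injective _≡_ _≡_ f → ∃ λ i → arrange i ≗ f
  arrange-covers {f} inj = rank π , λ x →
    trans (cong element (unrank-rank π (index x)))
      (trans (element-index _) (cong f (element-index x)))
    where
    π = mk↔ₛ′ (index ∘ f ∘ element) (index ∘ Inverse.from (bijection inj) ∘ element)
      (λ i → trans (cong (index ∘ f) (element-index _))
        (trans (cong index (Inverse.strictlyInverseˡ (bijection inj) _)) (index-element i)))
      (λ i → trans (cong (index ∘ Inverse.from (bijection inj)) (element-index _))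
        (trans (cong index (Inverse.strictlyInverseʳ (bijection inj) _)) (index-element i)))

module _ {A : Set} {q : ℕ} (A↔Fin : A ↔ Fin q) where
  Vec↔Fin : ∀ n → Vec A n ↔ Fin (q ℕ.^ n)
  Vec↔Fin zero    = mk↔ₛ′ (λ _ → zero) (λ _ → []) (λ { zero → refl }) (λ { [] → refl })
  Vec↔Fin (suc n) = mk↔ₛ′ to from to-from from-to
    where
    open Finite A↔Fin
    module V = Inverse (Vec↔Fin n)
    to : Vec A (suc n) → Fin (q ℕ.^ suc n)
    to (x ∷ xs) = combine (index x) (V.to xs)
    cons : Fin q × Fin (q ℕ.^ n) → Vec A (suc n)
    cons (i , j) = element i ∷ V.from j
    from : Fin (q ℕ.^ suc n) → Vec A (suc n)
    from = cons ∘ remQuot {q} (q ℕ.^ n)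
    to-from : ∀ i → to (from i) ≡ i
    to-from i = trans (cong₂ combine (index-element _) (V.strictlyInverseˡ _)) (Finₚ.combine-remQuot {q} (q ℕ.^ n) i)
    from-to : ∀ xs → from (to xs) ≡ xs
    from-to (x ∷ xs) = trans (cong cons (Finₚ.remQuot-combine (index x) (V.to xs)))
      (cong₂ _∷_ (element-index x) (V.strictlyInverseʳ xs))

-- Counting the permutations computed by short programs

module Programs {A : Set} {q : ℕ} (A↔Fin : A ↔ Fin q) (n : ℕ) where
  module Aᶠ = Finite A↔Fin
  module Rest = Finite (Vec↔Fin A↔Fin n)
  module Aⁿ = Finite (Vec↔Fin A↔Fin (suc n))

  -- The dimension is `suc n`, so the `n` coordinates other than the active one take `q ^ n` values.
  -- A bijective instruction permutes `A` in the active coordinate, independently for each of these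
  -- values.
  instructionCount : ℕ
  instructionCount = suc n ℕ.* (q !) ℕ.^ (q ℕ.^ n)

  update : Fin (suc n) → (Fin (q ℕ.^ n) → Fin (q !)) → Transformation A (suc n)
  update i φ x = insertAt (removeAt x i) i (Aᶠ.arrange (φ (Rest.index (removeAt x i))) (lookup x i))

  instruction : Fin instructionCount → Transformation A (suc n)
  instruction = uncurry (λ i → update i ∘ finToFun) ∘ remQuot {suc n} ((q !) ℕ.^ (q ℕ.^ n))

  Trivial? : (g : Transformation A (suc n)) → ∀ i → Dec (Trivial g i)
  Trivial? g i = Aⁿ.∀? λ x → lookup (g x) i Aᶠ.≟ lookup x i

  active : (g : Transformation A (suc n)) → IsInstruction g →
           ∃ λ i → ∀ j → i ≢ j → Trivial g j
  active g instr with Finₚ.any? (λ i → ¬? (Trivial? g i))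
  ... | yes (i , ¬triv) = i , λ j i≢j → decidable-stable (Trivial? g j) (i≢j ∘ instr i j ¬triv)
  -- Here every coordinate is trivial, so any index will do; `zero` exists because the dimension is
  -- `suc n`.
  ... | no  none = zero , λ j _ → decidable-stable (Trivial? g j) (λ ¬triv → none (j , ¬triv))

  module _ {g : Transformation A (suc n)} (inj : Injective _≡_ _≡_ g) (instr : IsInstruction g) where
    private
      i = proj₁ (active g instr)

      step : Vec A n → A → A
      step y a = lookup (g (insertAt y i a)) i

      lookup-removeAt : ∀ (x : Vec A (suc n)) j → lookup (removeAt x i) j ≡ lookup x (punchIn i j)
      lookup-removeAt x j = trans
        (sym (Vecₚ.insertAt-punchIn (removeAt x i) i (lookup x i) j))
        (cong (λ z → lookup z (punchIn i j)) (Vecₚ.insertAt-removeAt x i))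

      removeAt-g : ∀ x → removeAt (g x) i ≡ removeAt x i
      removeAt-g x = Pointwise-≡⇒≡ (ext λ j → trans (lookup-removeAt (g x) j)
        (trans (proj₂ (active g instr) (punchIn i j) (Finₚ.punchInᵢ≢i i j ∘ sym) x)
          (sym (lookup-removeAt x j))))

      g-insertAt : ∀ y a → g (insertAt y i a) ≡ insertAt y i (step y a)
      g-insertAt y a = trans (sym (Vecₚ.insertAt-removeAt (g (insertAt y i a)) i))
        (cong (λ z → insertAt z i (step y a))
          (trans (removeAt-g (insertAt y i a)) (Vecₚ.removeAt-insertAt y i a)))

      -- With the other coordinates frozen at `y`, the instruction changes only coordinate `i`, so a
      -- collision of `step y` would be a collision of `g`.
      step-injective : ∀ y → Injective _≡_ _≡_ (step y)
      step-injective y {a} {b} eq = trans (sym (Vecₚ.insertAt-lookup y i a))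
        (trans (cong (λ z → lookup z i) (inj (trans (g-insertAt y a)
          (trans (cong (insertAt y i) eq) (sym (g-insertAt y b))))))
        (Vecₚ.insertAt-lookup y i b))

      choice : ∀ y → ∃ λ k → Aᶠ.arrange k ≗ step y
      choice y = Aᶠ.arrange-covers (step-injective y)

      φ : Fin (q ℕ.^ n) → Fin (q !)
      φ = proj₁ ∘ choice ∘ Rest.element

      update-φ : update i φ ≗ g
      update-φ x = begin
        update i φ x
          ≡⟨ cong (insertAt y i) (proj₂ (choice _) (lookup x i)) ⟩
        insertAt y i (step (Rest.element (Rest.index y)) (lookup x i))
          ≡⟨ cong (λ z → insertAt y i (step z (lookup x i))) (Rest.element-index y) ⟩
        insertAt y i (step y (lookup x i))          ≡⟨ g-insertAt y (lookup x i) ⟨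
        g (insertAt y i (lookup x i))               ≡⟨ cong g (Vecₚ.insertAt-removeAt x i) ⟩
        g x                                         ∎
        where
        open ≡-Reasoning
        y = removeAt x i

    instruction-covers : ∃ λ b → instruction b ≗ g
    instruction-covers = combine i (funToFin φ) , λ x → begin
      instruction (combine i (funToFin φ)) x
        ≡⟨ cong (λ s → update (proj₁ s) (finToFun (proj₂ s)) x) (Finₚ.remQuot-combine i (funToFin φ)) ⟩
      update i (finToFun (funToFin φ)) x
        ≡⟨ cong (λ k → insertAt (removeAt x i) i (Aᶠ.arrange k (lookup x i))) (Finₚ.finToFun-funToFin φ _) ⟩
      update i φ x                             ≡⟨ update-φ x ⟩
      g x                                      ∎
      where open ≡-Reasoning

  program : ∀ k → Fin (instructionCount ℕ.^ k) → Transformation A (suc n)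
  program zero    _ = id
  program (suc k) = uncurry (λ b c → program k c ∘ instruction b) ∘ remQuot {instructionCount} (instructionCount ℕ.^ k)

  program-combine : ∀ k b c → program (suc k) (combine b c) ≗ program k c ∘ instruction b
  program-combine k b c x = cong (λ s → program k (proj₂ s) (instruction (proj₁ s) x)) (Finₚ.remQuot-combine b c)

  prepend : ∀ k {g h : Transformation A (suc n)} → (∃ λ b → instruction b ≗ g) →
            (∃ λ c → program k c ≗ h) → ∃ λ b → program (suc k) b ≗ h ∘ g
  prepend k {h = h} (b , b≗) (c , c≗) = combine b c , λ x →
    trans (program-combine k b c x) (trans (c≗ _) (cong h (b≗ x)))

  -- In an injective composite the map applied first is injective, hence surjective because the set
  -- is finite; cancelling it shows that the rest of the program is injective as well. So the
  -- induction meets bijective maps only.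
  program-covers : ∀ k (p : Program A (suc n)) → length p ≤ k → Injective _≡_ _≡_ ⟦ p ⟧ →
                   ∃ λ b → program k b ≗ ⟦ p ⟧
  program-covers zero    []      _   inj = zero , λ _ → refl
  program-covers (suc k) []      _   inj =
    prepend k (instruction-covers {id} id (λ _ _ ¬triv → contradiction (λ _ → refl) ¬triv))
      (program-covers k [] z≤n inj)
  program-covers (suc k) ((g , instr) ∷ p) (s≤s len) inj =
    prepend k (instruction-covers {g} g-injective instr) (program-covers k p len p-injective)
    where
    g-injective : Injective _≡_ _≡_ g
    g-injective = inj ∘ cong ⟦ p ⟧
    g-surjective = Aⁿ.surjective g-injective
    p-injective : Injective _≡_ _≡_ ⟦ p ⟧
    p-injective {x} {y} eq = trans (sym (proj₂ (g-surjective x))) (trans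
      (cong g (inj (trans (cong ⟦ p ⟧ (proj₂ (g-surjective x))) (trans eq (cong ⟦ p ⟧ (sym (proj₂ (g-surjective y))))))))
      (proj₂ (g-surjective y)))

  total : ℕ
  total = (q ℕ.^ suc n) !

  module _ {P : Transformation A (suc n) → Set} {c : ℕ} (count : HasCardinality (permutationsWith A (suc n) P) c) where
    open Inverse count using (to; from; strictlyInverseˡ; strictlyInverseʳ)

    count≤total : c ≤ total
    count≤total = Finₚ.injective⇒≤ {f = proj₁ ∘ code} λ {i} {j} eq →
      trans (sym (strictlyInverseʳ i)) (trans (Inverse.from-cong count (λ x →
        trans (sym (proj₂ (code i) x)) (trans (cong (λ k → Aⁿ.arrange k x) eq) (proj₂ (code j) x))))
        (strictlyInverseʳ j))
      where
      code : ∀ i → ∃ λ k → Aⁿ.arrange k ≗ Inverse.to (proj₁ (to i))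
      code i = Aⁿ.arrange-covers (Injection.injective (↔⇒↣ (proj₁ (to i))))

    -- Each permutation gets either its position in the list `F` or, if unlisted, its number among
    -- the permutations with `P`. The case split is on membership in the finite list, which is
    -- decidable, and not on `P`.
    total≤count+ : ∀ {B} (F : Fin B → Transformation A (suc n)) →
      (∀ (f : Permutation A (suc n)) → (¬ ∃ λ b → F b ≗ Inverse.to f) → P (Inverse.to f)) →
      total ≤ c ℕ.+ B
    total≤count+ {B} F good = Finₚ.injective⇒≤ {f = join c B ∘ classify} λ {i} {j} eq →
      classify-injective i j (trans (sym (Finₚ.splitAt-join c B (classify i)))
        (trans (cong (splitAt c) eq) (Finₚ.splitAt-join c B (classify j))))
      where
      listed? : ∀ i → Dec (∃ λ b → F b ≗ Aⁿ.arrange i)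
      listed? i = Finₚ.any? λ b → Aⁿ.∀? λ x → F b x Aⁿ.≟ Aⁿ.arrange i x
      classify : Fin total → Fin c ⊎ Fin B
      classify i with listed? i
      ... | yes (b , _) = inj₂ b
      ... | no ¬listed  = inj₁ (from (Aⁿ.arrangement i , good (Aⁿ.arrangement i) ¬listed))
      classify-injective : ∀ i j → classify i ≡ classify j → i ≡ j
      classify-injective i j eq with listed? i | listed? j
      classify-injective i j refl | yes (b , p) | yes (b , r) = Aⁿ.arrange-injective λ x → trans (sym (p x)) (r x)
      classify-injective i j eq   | no _  | no _ = Aⁿ.arrange-injective λ x →
        trans (sym (strictlyInverseˡ _ x)) (trans (Inverse.to-cong count (Sumₚ.inj₁-injective eq) x) (strictlyInverseˡ _ x))

  unlisted⇒complex : ∀ k (f : Permutation A (suc n)) →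
    (¬ ∃ λ b → program k b ≗ Inverse.to f) → ComplexityAtLeast (+ k ℤ.+ + 1) (Inverse.to f)
  unlisted⇒complex k f unlisted L ((p , p≗f , refl) , _) with L ℕₚ.≤? k
  ... | no L≰k = ℤ.+≤+ (subst (_≤ L) (ℕₚ.+-comm 1 k) (ℕₚ.≰⇒> L≰k))
  ... | yes L≤k with program-covers k p L≤k (λ {x} {y} eq →
                       Injection.injective (↔⇒↣ f) (trans (sym (p≗f x)) (trans eq (p≗f y))))
  ...   | b , b≗ = contradiction (b , λ x → trans (b≗ x) (p≗f x)) unlisted

-- Natural numbers inside the rationals

ι : ℕ → ℚ
ι n = + n ℚ./ 1

ι-suc : ∀ n → ι (suc n) ≡ 1ℚ ℚ.+ ι n
ι-suc n = trans (sym (ℚₚ.*-identityʳ (ι (suc n)))) (trans (sym (∑-const (suc n) 1ℚ))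
  (cong (1ℚ ℚ.+_) (trans (∑-const n 1ℚ) (ℚₚ.*-identityʳ (ι n)))))

ι-+ : ∀ m n → ι (m ℕ.+ n) ≡ ι m ℚ.+ ι n
ι-+ zero    n = sym (ℚₚ.+-identityˡ (ι n))
ι-+ (suc m) n = begin
  ι (suc (m ℕ.+ n))        ≡⟨ ι-suc (m ℕ.+ n) ⟩
  1ℚ ℚ.+ ι (m ℕ.+ n)       ≡⟨ cong (1ℚ ℚ.+_) (ι-+ m n) ⟩
  1ℚ ℚ.+ (ι m ℚ.+ ι n)     ≡⟨ ℚₚ.+-assoc 1ℚ (ι m) (ι n) ⟨
  1ℚ ℚ.+ ι m ℚ.+ ι n       ≡⟨ cong (ℚ._+ ι n) (ι-suc m) ⟨
  ι (suc m) ℚ.+ ι n        ∎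
  where open ≡-Reasoning

ι-* : ∀ m n → ι (m ℕ.* n) ≡ ι m ℚ.* ι n
ι-* zero    n = sym (ℚₚ.*-zeroˡ (ι n))
ι-* (suc m) n = begin
  ι (n ℕ.+ m ℕ.* n)           ≡⟨ ι-+ n (m ℕ.* n) ⟩
  ι n ℚ.+ ι (m ℕ.* n)         ≡⟨ cong₂ ℚ._+_ (sym (ℚₚ.*-identityˡ (ι n))) (ι-* m n) ⟩
  1ℚ ℚ.* ι n ℚ.+ ι m ℚ.* ι n  ≡⟨ ℚₚ.*-distribʳ-+ (ι n) 1ℚ (ι m) ⟨
  (1ℚ ℚ.+ ι m) ℚ.* ι n        ≡⟨ cong (ℚ._* ι n) (ι-suc m) ⟨
  ι (suc m) ℚ.* ι n           ∎
  where open ≡-Reasoning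

ι≥0 : ∀ n → 0ℚ ℚ.≤ ι n
ι≥0 n = ℚₚ.nonNegative⁻¹ (ι n) {{ℚₚ.normalize-nonNeg n 1}}

ι>0 : ∀ n .{{_ : NonZero n}} → 0ℚ ℚ.< ι n
ι>0 n = ℚₚ.positive⁻¹ (ι n) {{ℚₚ.normalize-pos n 1}}

ι-mono : ∀ {m n} → m ≤ n → ι m ℚ.≤ ι n
ι-mono {m} {n} m≤n = subst (ι m ℚ.≤_) (trans (sym (ι-+ m (n ℕ.∸ m))) (cong ι (ℕₚ.m+[n∸m]≡n m≤n)))
  (subst (ℚ._≤ ι m ℚ.+ ι (n ℕ.∸ m)) (ℚₚ.+-identityʳ (ι m)) (ℚₚ.+-monoʳ-≤ (ι m) (ι≥0 (n ℕ.∸ m))))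

ι*u : ∀ k → ι (suc k) ℚ.* u k ≡ 1ℚ
ι*u k = trans (sym (∑-const (suc k) (u k))) (∑-u k k 0 (sym (ℕₚ.*-identityʳ (suc k))))

ι*recip : ∀ m .{{_ : NonZero m}} → ι m ℚ.* (+ 1 ℚ./ m) ≡ 1ℚ
ι*recip (suc k) = ι*u k

ι*ratio : ∀ c m .{{_ : NonZero m}} → ι m ℚ.* (+ c ℚ./ m) ≡ ι c
ι*ratio c m@(suc k) = ℚₚ.toℚᵘ-injective (begin
  ℚ.toℚᵘ (ι m ℚ.* (+ c ℚ./ m))            ≈⟨ ℚₚ.toℚᵘ-homo-* (ι m) (+ c ℚ./ m) ⟩
  ℚ.toℚᵘ (ι m) ℚᵘ.* ℚ.toℚᵘ (+ c ℚ./ m)    ≈⟨ ℚᵘₚ.*-cong (ℚₚ.toℚᵘ-fromℚᵘ (ℚᵘ.mkℚᵘ (+ m) 0)) (ℚₚ.toℚᵘ-fromℚᵘ (ℚᵘ.mkℚᵘ (+ c) k)) ⟩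
  ℚᵘ.mkℚᵘ (+ m) 0 ℚᵘ.* ℚᵘ.mkℚᵘ (+ c) k    ≈⟨ ℚᵘ.*≡* cross ⟩
  ℚᵘ.mkℚᵘ (+ c) 0                         ≈⟨ ℚᵘₚ.≃-sym (ℚₚ.toℚᵘ-fromℚᵘ (ℚᵘ.mkℚᵘ (+ c) 0)) ⟩
  ℚ.toℚᵘ (ι c)                            ∎)
  where
  open ℚᵘₚ.≃-Reasoning
  cross : (+ m ℤ.* + c) ℤ.* + 1 ≡ + c ℤ.* + (1 ℕ.* m)
  cross = trans (ℤₚ.*-identityʳ (+ m ℤ.* + c)) (trans (ℤₚ.*-comm (+ m) (+ c))
    (cong (λ d → + c ℤ.* + d) (sym (ℕₚ.*-identityˡ m))))

-- Comparing sequences up to an eventual tolerance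

infix 4 _≲_ _≋_

-- The order ≤ᴿ on the underlying sequences, as a record so that both sides can be inferred.
record _≲_ (s t : ℕ → ℚ) : Set where
  constructor eventually
  field within : ∀ ε → 0ℚ ℚ.< ε → ∃ λ N → ∀ j → N ≤ j → s j ℚ.≤ t j ℚ.+ ε

open _≲_

_≋_ : (s t : ℕ → ℚ) → Set
s ≋ t = s ≲ t × t ≲ s

private variable
  s s′ t t′ v : ℕ → ℚ

pointwise : (∀ j → s j ℚ.≤ t j) → s ≲ t
pointwise {s} {t} s≤t = eventually λ ε ε>0 → 0 , λ j _ → ℚₚ.≤-trans (s≤t j)
  (subst (ℚ._≤ t j ℚ.+ ε) (ℚₚ.+-identityʳ (t j)) (ℚₚ.+-monoʳ-≤ (t j) (ℚₚ.<⇒≤ ε>0)))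

pointwise-≡ : s ≗ t → s ≲ t
pointwise-≡ s≗t = pointwise (ℚₚ.≤-reflexive ∘ s≗t)

≗⇒≋ : s ≗ t → s ≋ t
≗⇒≋ s≗t = pointwise-≡ s≗t , pointwise-≡ (sym ∘ s≗t)

≲-refl : s ≲ s
≲-refl = pointwise λ _ → ℚₚ.≤-refl

≲-trans : s ≲ t → t ≲ v → s ≲ v
≲-trans {s} {t} {v} s≲t t≲v = eventually λ ε ε>0 →
  let N , h = within s≲t (½ ℚ.* ε) (half>0 ε>0)
      M , k = within t≲v (½ ℚ.* ε) (half>0 ε>0)
  in N ℕ.⊔ M , λ j Lj → ℚₚ.≤-trans (h j (≤⊔ˡ {N} {M} Lj))
    (subst (t j ℚ.+ ½ ℚ.* ε ℚ.≤_)
      (trans (ℚₚ.+-assoc (v j) (½ ℚ.* ε) (½ ℚ.* ε)) (cong (v j ℚ.+_) (half+half ε)))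
      (ℚₚ.+-monoˡ-≤ (½ ℚ.* ε) (k j (≤⊔ʳ {N} {M} Lj))))

≋-refl : ∀ s → s ≋ s
≋-refl s = ≲-refl , ≲-refl

≋-trans : s ≋ t → t ≋ v → s ≋ v
≋-trans (s≲t , t≲s) (t≲v , v≲t) = ≲-trans s≲t t≲v , ≲-trans v≲t t≲s

module ≲-Reasoning = SingleReasoning _≲_ ≲-refl ≲-trans

+-mono-≲ : s ≲ t → s′ ≲ t′ → (λ j → s j ℚ.+ s′ j) ≲ (λ j → t j ℚ.+ t′ j)
+-mono-≲ {s} {t} {s′} {t′} s≲t s′≲t′ = eventually λ ε ε>0 →
  let N , h = within s≲t (½ ℚ.* ε) (half>0 ε>0)
      M , k = within s′≲t′ (½ ℚ.* ε) (half>0 ε>0)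
  in N ℕ.⊔ M , λ j Lj →
    subst (s j ℚ.+ s′ j ℚ.≤_)
      (trans (shuffle (t j) (½ ℚ.* ε) (t′ j)) (cong (t j ℚ.+ t′ j ℚ.+_) (half+half ε)))
      (ℚₚ.+-mono-≤ (h j (≤⊔ˡ {N} {M} Lj)) (k j (≤⊔ʳ {N} {M} Lj)))
  where
  shuffle : ∀ a e b → (a ℚ.+ e) ℚ.+ (b ℚ.+ e) ≡ a ℚ.+ b ℚ.+ (e ℚ.+ e)
  shuffle = solve 3 (λ a e b → (a :+ e) :+ (b :+ e) := a :+ b :+ (e :+ e)) refl
    where open ℚ-Solver

+-monoˡ-≲ : ∀ v → s ≲ t → (λ j → s j ℚ.+ v j) ≲ (λ j → t j ℚ.+ v j)
+-monoˡ-≲ v s≲t = +-mono-≲ s≲t (≲-refl {v})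

+-monoʳ-≲ : ∀ v → s ≲ t → (λ j → v j ℚ.+ s j) ≲ (λ j → v j ℚ.+ t j)
+-monoʳ-≲ v s≲t = +-mono-≲ (≲-refl {v}) s≲t

*-monoʳ-≲ : ∀ a → 0ℚ ℚ.≤ a → s ≲ t → (λ j → a ℚ.* s j) ≲ (λ j → a ℚ.* t j)
*-monoʳ-≲ {s} {t} a a≥0 s≲t = eventually λ ε ε>0 →
  -- The factor `a + 1` is positive even when `a` is 0, so the tolerance can be divided by it.
  let δ , δ>0 , Bδ = scale (a ℚ.+ 1ℚ) ε a+1>0 ε>0
      N , h = within s≲t δ δ>0
  in N , λ j Nj → begin
    a ℚ.* s j                          ≤⟨ ℚₚ.*-monoˡ-≤-nonNeg a {{a⁺}} (h j Nj) ⟩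
    a ℚ.* (t j ℚ.+ δ)                  ≡⟨ ℚₚ.*-distribˡ-+ a (t j) δ ⟩
    a ℚ.* t j ℚ.+ a ℚ.* δ
      ≤⟨ ℚₚ.+-monoʳ-≤ (a ℚ.* t j) (ℚₚ.*-monoʳ-≤-nonNeg δ {{ℚ.nonNegative (ℚₚ.<⇒≤ δ>0)}} a≤a+1) ⟩
    a ℚ.* t j ℚ.+ (a ℚ.+ 1ℚ) ℚ.* δ     ≡⟨ cong (a ℚ.* t j ℚ.+_) Bδ ⟩
    a ℚ.* t j ℚ.+ ε                    ∎
  where
  open ℚₚ.≤-Reasoning
  a⁺ = ℚ.nonNegative a≥0
  a+1>0 : 0ℚ ℚ.< a ℚ.+ 1ℚ
  a+1>0 = ℚₚ.positive⁻¹ _ {{ℚₚ.nonNeg+pos⇒pos a {{a⁺}} 1ℚ}}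
  a≤a+1 : a ℚ.≤ a ℚ.+ 1ℚ
  a≤a+1 = subst (ℚ._≤ a ℚ.+ 1ℚ) (ℚₚ.+-identityʳ a) (ℚₚ.+-monoʳ-≤ a (ℚₚ.<⇒≤ (ℚₚ.positive⁻¹ 1ℚ)))

+-cong-≋ : s ≋ t → s′ ≋ t′ → (λ j → s j ℚ.+ s′ j) ≋ (λ j → t j ℚ.+ t′ j)
+-cong-≋ (a , b) (c , d) = +-mono-≲ a c , +-mono-≲ b d

-- Whenever `j` is past a Cauchy threshold, so is `φ j`. This turns exact identities between Riemann
-- sums on different meshes into relations between the limits.
reindex : ∀ s → SeqCauchy s → (φ : ℕ → ℕ) → (∀ j → j ≤ φ j) → s ∘ φ ≋ s
reindex s cs φ j≤φj = eventually (λ ε ε>0 → let N , h = cs ε ε>0 in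
    N , λ j Nj → bound-by (s (φ j)) (s j) ε (h (φ j) j (ℕₚ.≤-trans Nj (j≤φj j)) Nj))
  , eventually (λ ε ε>0 → let N , h = cs ε ε>0 in
    N , λ j Nj → bound-by (s j) (s (φ j)) ε (h j (φ j) Nj (ℕₚ.≤-trans Nj (j≤φj j))))
  where
  p≤∣p∣ : ∀ p → p ℚ.≤ ∣ p ∣
  p≤∣p∣ p with ℚₚ.≤-total 0ℚ p
  ... | inj₁ 0≤p = ℚₚ.≤-reflexive (sym (ℚₚ.0≤p⇒∣p∣≡p 0≤p))
  ... | inj₂ p≤0 = ℚₚ.≤-trans p≤0 (ℚₚ.0≤∣p∣ p)
  bound-by : ∀ a b ε → ∣ a ℚ.- b ∣ ℚ.< ε → a ℚ.≤ b ℚ.+ ε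
  bound-by a b ε lt = subst (ℚ._≤ b ℚ.+ ε) (sym (add-sub a b))
    (ℚₚ.+-monoʳ-≤ b (ℚₚ.≤-trans (p≤∣p∣ (a ℚ.- b)) (ℚₚ.<⇒≤ lt)))

clear-divisor : ∀ {z x y r δ B ε} → 0ℚ ℚ.≤ δ → 0ℚ ℚ.≤ y → y ℚ.≤ B → B ℚ.* δ ≡ ε → r ℚ.* y ≡ 1ℚ →
                z ℚ.≤ x ℚ.* r ℚ.+ δ → z ℚ.* y ℚ.≤ x ℚ.+ ε
clear-divisor {z} {x} {y} {r} {δ} {B} {ε} δ≥0 y≥0 y≤B Bδ ry≡1 z≤ = begin
  z ℚ.* y                           ≤⟨ ℚₚ.*-monoʳ-≤-nonNeg y {{ℚ.nonNegative y≥0}} z≤ ⟩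
  (x ℚ.* r ℚ.+ δ) ℚ.* y             ≡⟨ expand x r δ y ⟩
  x ℚ.* (r ℚ.* y) ℚ.+ y ℚ.* δ       ≡⟨ cong (λ o → x ℚ.* o ℚ.+ y ℚ.* δ) ry≡1 ⟩
  x ℚ.* 1ℚ ℚ.+ y ℚ.* δ              ≡⟨ cong (ℚ._+ y ℚ.* δ) (ℚₚ.*-identityʳ x) ⟩
  x ℚ.+ y ℚ.* δ                     ≤⟨ ℚₚ.+-monoʳ-≤ x (ℚₚ.*-monoʳ-≤-nonNeg δ {{ℚ.nonNegative δ≥0}} y≤B) ⟩
  x ℚ.+ B ℚ.* δ                     ≡⟨ cong (x ℚ.+_) Bδ ⟩
  x ℚ.+ ε                           ∎
  where
  open ℚₚ.≤-Reasoning
  expand : ∀ x r d y → (x ℚ.* r ℚ.+ d) ℚ.* y ≡ x ℚ.* (r ℚ.* y) ℚ.+ y ℚ.* d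
  expand = solve 4 (λ x r d y → (x :* r :+ d) :* y := x :* (r :* y) :+ y :* d) refl
    where open ℚ-Solver

-- Multiplying by `y` enlarges the tolerance by a factor that is eventually at most `B`, so the
-- hypothesis is applied with ε/B. The index must also pass `N₀`, from where on the clamped
-- reciprocal inside `inv` is the true one.
divide-≤ : ∀ z x y (y>0 : 0ᴿ <ᴿ y) → z ≤ᴿ divide x y y>0 →
           (λ j → seq z j ℚ.* seq y j) ≲ seq x
divide-≤ z x y (ε₀ , ε₀>0 , N₀ , h₀) z≤ = eventually go
  where
  open Recip ε₀ ε₀>0
  B = proj₁ (bounded {seq y} (cauchy y))
  B>0 = proj₁ (proj₂ (bounded {seq y} (cauchy y)))
  N₁ = proj₁ (proj₂ (proj₂ (bounded {seq y} (cauchy y))))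
  h₁ = proj₂ (proj₂ (proj₂ (bounded {seq y} (cauchy y))))
  ε₀≤y : ∀ j → N₀ ≤ j → ε₀ ℚ.≤ seq y j
  ε₀≤y j Nj = subst (ℚ._≤ seq y j) (ℚₚ.+-identityˡ ε₀) (h₀ j Nj)
  y≥0 : ∀ j → N₀ ≤ j → 0ℚ ℚ.≤ seq y j
  y≥0 j Nj = ℚₚ.≤-trans (ℚₚ.<⇒≤ ε₀>0) (ε₀≤y j Nj)
  go : ∀ ε → 0ℚ ℚ.< ε → ∃ λ N → ∀ j → N ≤ j → seq z j ℚ.* seq y j ℚ.≤ seq x j ℚ.+ ε
  go ε ε>0 =
    let δ , δ>0 , Bδ = scale B ε B>0 ε>0
        N₂ , h₂ = z≤ δ δ>0
    in (N₀ ℕ.⊔ N₁) ℕ.⊔ N₂ , λ j Lj →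
      let N₀j = ≤⊔ˡ {N₀} {N₁} (≤⊔ˡ {N₀ ℕ.⊔ N₁} {N₂} Lj)
          N₁j = ≤⊔ʳ {N₀} {N₁} (≤⊔ˡ {N₀ ℕ.⊔ N₁} {N₂} Lj)
      in clear-divisor {x = seq x j} {r = recip (seq y j)} (ℚₚ.<⇒≤ δ>0) (y≥0 j N₀j)
           (subst (ℚ._≤ B) (ℚₚ.0≤p⇒∣p∣≡p (y≥0 j N₀j)) (h₁ j N₁j))
           Bδ (recip-inv (seq y j) (ε₀≤y j N₀j)) (h₂ j (≤⊔ʳ {N₀ ℕ.⊔ N₁} {N₂} Lj))

-- Functional equation and monotonicity of the logarithm

-- The sum for a b at index j is the sum for a followed by that for b on the mesh 1/(a (j + 1)).
log-* : ∀ a b .{{_ : NonZero a}} .{{_ : NonZero b}} →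
        logSeq (a ℕ.* b) ≋ (λ j → logSeq a j ℚ.+ logSeq b j)
log-* (suc a) (suc b) = ≋-trans (≗⇒≋ split)
  (+-cong-≋ (≋-refl (logSeq (suc a))) (reindex (logSeq (suc b)) (log-cauchy (suc b)) φ λ j → ℕₚ.m≤m+n j (a ℕ.* suc j)))
  where
  φ : ℕ → ℕ
  φ j = j ℕ.+ a ℕ.* suc j
  len : ∀ j → (b ℕ.+ a ℕ.* suc b) ℕ.* suc j ≡ a ℕ.* suc j ℕ.+ b ℕ.* suc (φ j)
  len = solve 3 (λ a b j → (b :+ a :* (con 1 :+ b)) :* (con 1 :+ j) :=
    a :* (con 1 :+ j) :+ b :* (con 1 :+ (j :+ a :* (con 1 :+ j)))) refl a b
    where open ℕ-Solver
  split : ∀ j → logSeq (suc a ℕ.* suc b) j ≡ logSeq (suc a) j ℚ.+ logSeq (suc b) (φ j)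
  split j = trans (cong (λ l → ∑ l (λ i → u (j ℕ.+ i))) (len j))
    (trans (∑-split (a ℕ.* suc j) (b ℕ.* suc (φ j)) (λ i → u (j ℕ.+ i)))
      (cong (logSeq (suc a) j ℚ.+_) (∑-cong (b ℕ.* suc (φ j)) λ i →
        cong u (sym (ℕₚ.+-assoc j (a ℕ.* suc j) i)))))

log-^ : ∀ a k .{{_ : NonZero a}} → logSeq (a ℕ.^ k) ≋ (λ j → ι k ℚ.* logSeq a j)
log-^ a zero    = ≗⇒≋ λ j → sym (ℚₚ.*-zeroˡ (logSeq a j))
log-^ a (suc k) = ≋-trans (log-* a (a ℕ.^ k))
  (≋-trans (+-cong-≋ (≋-refl (logSeq a)) (log-^ a k)) (≗⇒≋ λ j → begin
    logSeq a j ℚ.+ ι k ℚ.* logSeq a j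
      ≡⟨ cong (ℚ._+ ι k ℚ.* logSeq a j) (ℚₚ.*-identityˡ (logSeq a j)) ⟨
    1ℚ ℚ.* logSeq a j ℚ.+ ι k ℚ.* logSeq a j   ≡⟨ ℚₚ.*-distribʳ-+ (logSeq a j) 1ℚ (ι k) ⟨
    (1ℚ ℚ.+ ι k) ℚ.* logSeq a j                ≡⟨ cong (ℚ._* logSeq a j) (ι-suc k) ⟨
    ι (suc k) ℚ.* logSeq a j                   ∎))
  where
  open ≡-Reasoning
  instance
    a^k≢0 : NonZero (a ℕ.^ k)
    a^k≢0 = ℕₚ.m^n≢0 a k

-- The last `suc j` terms form the Riemann sum of 1/t over [m + 1, m + 2] for the mesh 1/(j + 1).
log-suc : ∀ m j → logSeq (suc (suc m)) j ≡
          logSeq (suc m) j ℚ.+ ∑ (suc j) (λ i → u (j ℕ.+ (m ℕ.* suc j ℕ.+ i)))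
log-suc m j = trans (cong (λ l → ∑ l (λ i → u (j ℕ.+ i))) (ℕₚ.+-comm (suc j) (m ℕ.* suc j)))
  (∑-split (m ℕ.* suc j) (suc j) (λ i → u (j ℕ.+ i)))

-- Each of the `suc j` new terms is at least the mesh times the value of 1/t at the right endpoint m
-- + 2. The resulting gap does not depend on `j`, so it survives in the limit.
log-suc-≥ : ∀ m j → logSeq (suc m) j ℚ.+ u (suc m) ℚ.≤ logSeq (suc (suc m)) j
log-suc-≥ m j = subst (logSeq (suc m) j ℚ.+ u (suc m) ℚ.≤_) (sym (log-suc m j))
  (ℚₚ.+-monoʳ-≤ (logSeq (suc m) j) (subst (ℚ._≤ ∑ (suc j) (λ i → u (j ℕ.+ (m ℕ.* suc j ℕ.+ i))))
    (∑-u j (j ℕ.+ (m ℕ.* suc j ℕ.+ suc j)) (suc m) (nat j m))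
    (∑-mono (suc j) _ _ λ i i<j → u-anti (ℕₚ.+-monoʳ-≤ j (ℕₚ.+-monoʳ-≤ (m ℕ.* suc j) (ℕₚ.<⇒≤ i<j))))))
  where
  nat : ∀ j m → suc (j ℕ.+ (m ℕ.* suc j ℕ.+ suc j)) ≡ suc j ℕ.* suc (suc m)
  nat = solve 2 (λ j m → con 1 :+ (j :+ (m :* (con 1 :+ j) :+ (con 1 :+ j))) :=
    (con 1 :+ j) :* (con 1 :+ (con 1 :+ m))) refl
    where open ℕ-Solver

log-mono : ∀ {m n} → m ≤ n → ∀ j → logSeq m j ℚ.≤ logSeq n j
log-mono {m} {n} m≤n j = subst₂ ℚ._≤_ (ℚₚ.+-identityʳ (logSeq m j))
  (trans (sym (∑-split a b f)) (cong (λ l → ∑ l f) (ℕₚ.m+[n∸m]≡n (ℕₚ.*-monoˡ-≤ (suc j) (ℕₚ.∸-monoˡ-≤ 1 m≤n)))))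
  (ℚₚ.+-monoʳ-≤ (logSeq m j) (∑-nonneg b _ λ i → u≥0 (j ℕ.+ (a ℕ.+ i))))
  where
  f = λ i → u (j ℕ.+ i)
  a = (m ℕ.∸ 1) ℕ.* suc j
  b = (n ℕ.∸ 1) ℕ.* suc j ℕ.∸ a

-- If n < m, the sums differ at every index by at least the fixed gap 1/(n + 1), which a tolerance
-- of half that gap contradicts. This is the passage from logarithms back to natural numbers.
log-cancel-≤ : ∀ m n .{{_ : NonZero n}} → logSeq m ≲ logSeq n → m ≤ n
log-cancel-≤ m (suc n) m≲n with ℕₚ.≤-<-connex m (suc n)
... | inj₁ m≤n = m≤n
... | inj₂ n<m = contradiction
  (ℚₚ.≤-<-trans (ℚₚ.≤-trans (log-suc-≥ n N) (ℚₚ.≤-trans (log-mono n<m N) (h N ℕₚ.≤-refl)))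
    (ℚₚ.+-monoʳ-< (logSeq (suc n) N) ½u<u))
  (ℚₚ.<-irrefl refl)
  where
  N = proj₁ (within m≲n (½ ℚ.* u (suc n)) (half>0 (u>0 (suc n))))
  h = proj₂ (within m≲n (½ ℚ.* u (suc n)) (half>0 (u>0 (suc n))))
  ½u<u : ½ ℚ.* u (suc n) ℚ.< u (suc n)
  ½u<u = subst₂ ℚ._<_ (ℚₚ.+-identityʳ _) (half+half (u (suc n)))
    (ℚₚ.+-monoʳ-< (½ ℚ.* u (suc n)) (half>0 (u>0 (suc n))))

-- A lower bound of Stirling type for the factorial

-- The upper Riemann sum of 1/t over [m + 1 , m + 2] for the mesh 1/2.
slope : ℕ → ℚ
slope m = u (suc (m ℕ.+ m)) ℚ.+ u (suc (suc (m ℕ.+ m)))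

log-suc-≤ : ∀ m → logSeq (suc (suc m)) ≲ (λ j → logSeq (suc m) j ℚ.+ slope m)
log-suc-≤ m = begin
  logSeq (suc (suc m))
    -- Since `common 1 j + 1` is 2 (j + 1), the refined mesh has an even number of cells per unit
    -- interval. The new terms then split into two blocks of `suc j`, each term bounded by the first
    -- of its block.
    ∼⟨ proj₂ (reindex (logSeq (suc (suc m))) (log-cauchy (suc (suc m))) (common 1) j≤) ⟩
  logSeq (suc (suc m)) ∘ common 1           ∼⟨ pointwise step ⟩
  (λ j → logSeq (suc m) (common 1 j) ℚ.+ slope m)
    ∼⟨ +-monoˡ-≲ (λ _ → slope m) (proj₁ (reindex (logSeq (suc m)) (log-cauchy (suc m)) (common 1) j≤)) ⟩
  (λ j → logSeq (suc m) j ℚ.+ slope m)      ∎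
  where
  open ≲-Reasoning
  j≤ : ∀ j → j ≤ common 1 j
  j≤ j = ℕₚ.m≤m+n j (1 ℕ.* suc j)
  nat : ∀ i m j → suc (common 1 j ℕ.+ (m ℕ.* suc (common 1 j) ℕ.+ i ℕ.* suc j)) ≡ suc j ℕ.* suc (suc (m ℕ.+ m) ℕ.+ i)
  nat = solve 3 (λ i m j →
    con 1 :+ ((j :+ con 1 :* (con 1 :+ j)) :+ (m :* (con 1 :+ (j :+ con 1 :* (con 1 :+ j))) :+ i :* (con 1 :+ j))) :=
    (con 1 :+ j) :* (con 1 :+ (con 1 :+ (m :+ m) :+ i))) refl
    where open ℕ-Solver
  step : ∀ j → logSeq (suc (suc m)) (common 1 j) ℚ.≤ logSeq (suc m) (common 1 j) ℚ.+ slope m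
  step j = subst (ℚ._≤ logSeq (suc m) k ℚ.+ slope m) (sym (log-suc m k))
    (ℚₚ.+-monoʳ-≤ (logSeq (suc m) k) (subst (∑ (suc k) g ℚ.≤_) two
      (∑-blocks-≤ 2 (suc j) g (λ i → u (suc (m ℕ.+ m) ℕ.+ i)) λ i →
        ℚₚ.≤-trans
          (∑-mono (suc j) _ (λ _ → g (i ℕ.* suc j)) λ l _ →
            u-anti (ℕₚ.+-monoʳ-≤ k (ℕₚ.+-monoʳ-≤ (m ℕ.* suc k) (ℕₚ.m≤m+n (i ℕ.* suc j) l))))
          (ℚₚ.≤-reflexive (∑-u j (k ℕ.+ (m ℕ.* suc k ℕ.+ i ℕ.* suc j)) (suc (m ℕ.+ m) ℕ.+ i) (nat i m j))))))
    where
    k = common 1 j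
    g : ℕ → ℚ
    g i = u (k ℕ.+ (m ℕ.* suc k ℕ.+ i))
    two : ∑ 2 (λ i → u (suc (m ℕ.+ m) ℕ.+ i)) ≡ slope m
    two = cong₂ ℚ._+_ (cong (u ∘ suc) (ℕₚ.+-identityʳ (m ℕ.+ m)))
      (trans (ℚₚ.+-identityʳ _) (cong (u ∘ suc) (ℕₚ.+-comm (m ℕ.+ m) 1)))

5ℚ = ι 5

-- The two sides differ by p r a.
slope-algebra : ∀ a p r → 0ℚ ℚ.≤ a → 0ℚ ℚ.≤ p → 0ℚ ℚ.≤ r →
  (1ℚ ℚ.+ (1ℚ ℚ.+ (a ℚ.+ a))) ℚ.* p ≡ 1ℚ → (1ℚ ℚ.+ (1ℚ ℚ.+ (1ℚ ℚ.+ (a ℚ.+ a)))) ℚ.* r ≡ 1ℚ →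
  (5ℚ ℚ.* (1ℚ ℚ.+ a) ℚ.+ 1ℚ) ℚ.* (p ℚ.+ r) ℚ.≤ 5ℚ
slope-algebra a p r a≥0 p≥0 r≥0 eq₁ eq₂ = begin
  lhs                         ≡⟨ ℚₚ.+-identityʳ lhs ⟨
  lhs ℚ.+ 0ℚ                  ≤⟨ ℚₚ.+-monoʳ-≤ lhs gap≥0 ⟩
  lhs ℚ.+ p ℚ.* r ℚ.* a       ≡⟨ expand a p r ⟩
  combination ((1ℚ ℚ.+ (1ℚ ℚ.+ (a ℚ.+ a))) ℚ.* p) ((1ℚ ℚ.+ (1ℚ ℚ.+ (1ℚ ℚ.+ (a ℚ.+ a)))) ℚ.* r)
    ≡⟨ cong₂ combination eq₁ eq₂ ⟩
  combination 1ℚ 1ℚ           ≡⟨ simplify p r ⟩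
  5ℚ                          ∎
  where
  open ℚₚ.≤-Reasoning
  open ℚ-Solver
  5/2 = + 5 ℚ./ 2
  3/2 = + 3 ℚ./ 2
  lhs = (5ℚ ℚ.* (1ℚ ℚ.+ a) ℚ.+ 1ℚ) ℚ.* (p ℚ.+ r)
  -- Write 5a + 6 as 5/2 (2a + 2) + 1 in front of `p` and as 5/2 (2a + 3) - 3/2 in front of `r`. The
  -- last two summands vanish at x = y = 1 and absorb the remainders `p` and -3/2 `r` at the cost of
  -- `p r a`.
  combination : ℚ → ℚ → ℚ
  combination x y = 5/2 ℚ.* x ℚ.+ 5/2 ℚ.* y ℚ.+ p ℚ.* (1ℚ ℚ.- y) ℚ.- 3/2 ℚ.* r ℚ.* (1ℚ ℚ.- x)
  gap≥0 : 0ℚ ℚ.≤ p ℚ.* r ℚ.* a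
  gap≥0 = ℚₚ.nonNegative⁻¹ _ {{ℚₚ.nonNeg*nonNeg⇒nonNeg (p ℚ.* r)
    {{ℚₚ.nonNeg*nonNeg⇒nonNeg p {{ℚ.nonNegative p≥0}} r {{ℚ.nonNegative r≥0}}}}
    a {{ℚ.nonNegative a≥0}}}}
  expand : ∀ a p r → (5ℚ ℚ.* (1ℚ ℚ.+ a) ℚ.+ 1ℚ) ℚ.* (p ℚ.+ r) ℚ.+ p ℚ.* r ℚ.* a ≡
    5/2 ℚ.* ((1ℚ ℚ.+ (1ℚ ℚ.+ (a ℚ.+ a))) ℚ.* p)
      ℚ.+ 5/2 ℚ.* ((1ℚ ℚ.+ (1ℚ ℚ.+ (1ℚ ℚ.+ (a ℚ.+ a)))) ℚ.* r)
      ℚ.+ p ℚ.* (1ℚ ℚ.- (1ℚ ℚ.+ (1ℚ ℚ.+ (1ℚ ℚ.+ (a ℚ.+ a)))) ℚ.* r)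
      ℚ.- 3/2 ℚ.* r ℚ.* (1ℚ ℚ.- (1ℚ ℚ.+ (1ℚ ℚ.+ (a ℚ.+ a))) ℚ.* p)
  expand = solve 3 (λ a p r →
    let x = (con 1ℚ :+ (con 1ℚ :+ (a :+ a))) :* p
        y = (con 1ℚ :+ (con 1ℚ :+ (con 1ℚ :+ (a :+ a)))) :* r
    in (con 5ℚ :* (con 1ℚ :+ a) :+ con 1ℚ) :* (p :+ r) :+ p :* r :* a :=
      con 5/2 :* x :+ con 5/2 :* y :+ p :* (con 1ℚ :- y) :- con 3/2 :* r :* (con 1ℚ :- x)) refl
  simplify : ∀ p r → 5/2 ℚ.* 1ℚ ℚ.+ 5/2 ℚ.* 1ℚ ℚ.+ p ℚ.* (1ℚ ℚ.- 1ℚ) ℚ.- 3/2 ℚ.* r ℚ.* (1ℚ ℚ.- 1ℚ) ≡ 5ℚ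
  simplify = solve 2 (λ p r → con 5/2 :* con 1ℚ :+ con 5/2 :* con 1ℚ :+ p :* (con 1ℚ :- con 1ℚ)
    :- con 3/2 :* r :* (con 1ℚ :- con 1ℚ) := con 5ℚ) refl

slope-bound : ∀ m → (5ℚ ℚ.* ι (suc m) ℚ.+ 1ℚ) ℚ.* slope m ℚ.≤ 5ℚ
slope-bound m = subst (λ x → (5ℚ ℚ.* x ℚ.+ 1ℚ) ℚ.* slope m ℚ.≤ 5ℚ) (sym (ι-suc m))
  (slope-algebra (ι m) (u m₁) (u m₂) (ι≥0 m) (u≥0 m₁) (u≥0 m₂)
    (trans (cong (λ x → (1ℚ ℚ.+ x) ℚ.* u m₁) (sym ι-m₁)) (trans (cong (ℚ._* u m₁) (sym (ι-suc m₁))) (ι*u m₁)))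
    (trans (cong (λ x → (1ℚ ℚ.+ x) ℚ.* u m₂) (sym ι-m₂)) (trans (cong (ℚ._* u m₂) (sym (ι-suc m₂))) (ι*u m₂))))
  where
  m₁ = suc (m ℕ.+ m)
  m₂ = suc m₁
  ι-m₁ : ι m₁ ≡ 1ℚ ℚ.+ (ι m ℚ.+ ι m)
  ι-m₁ = trans (ι-suc (m ℕ.+ m)) (cong (1ℚ ℚ.+_) (ι-+ m m))
  ι-m₂ : ι m₂ ≡ 1ℚ ℚ.+ (1ℚ ℚ.+ (ι m ℚ.+ ι m))
  ι-m₂ = trans (ι-suc m₁) (cong (1ℚ ℚ.+_) ι-m₁)

stirling : ∀ m → (λ j → (5ℚ ℚ.* ι (suc m) ℚ.+ 1ℚ) ℚ.* logSeq (suc m) j) ≲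
                 (λ j → 5ℚ ℚ.* logSeq (suc m !) j ℚ.+ 5ℚ ℚ.* ι (suc m))
stirling zero    = pointwise λ j → 6*0≤5*0+5
  where
  6*0≤5*0+5 : (5ℚ ℚ.* ι 1 ℚ.+ 1ℚ) ℚ.* 0ℚ ℚ.≤ 5ℚ ℚ.* 0ℚ ℚ.+ 5ℚ ℚ.* ι 1
  6*0≤5*0+5 = ℚₚ.nonNegative⁻¹ _
stirling (suc m) = begin
  -- Splitting off 5 log(n+1) leaves the coefficient 5n + 1 of the previous case. The part split off
  -- completes log n! to log (n+1)!, and replacing log(n+1) by log n in the rest costs at most 5,
  -- the growth of the linear term.
  (λ j → (5ℚ ℚ.* ι (suc n) ℚ.+ 1ℚ) ℚ.* L j)
    ∼⟨ pointwise-≡ (λ j → trans (cong (λ a → (5ℚ ℚ.* a ℚ.+ 1ℚ) ℚ.* L j) (ι-suc n)) (split (ι n) (L j))) ⟩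
  (λ j → 5ℚ ℚ.* L j ℚ.+ c ℚ.* L j)
    ∼⟨ +-monoʳ-≲ (λ j → 5ℚ ℚ.* L j) (*-monoʳ-≲ c c≥0 (log-suc-≤ m)) ⟩
  (λ j → 5ℚ ℚ.* L j ℚ.+ c ℚ.* (logSeq n j ℚ.+ slope m))
    ∼⟨ pointwise (λ j → ℚₚ.≤-trans (ℚₚ.≤-reflexive (distribute (5ℚ ℚ.* L j) c (logSeq n j) (slope m)))
         (ℚₚ.+-monoʳ-≤ (5ℚ ℚ.* L j ℚ.+ c ℚ.* logSeq n j) (slope-bound m))) ⟩
  (λ j → 5ℚ ℚ.* L j ℚ.+ c ℚ.* logSeq n j ℚ.+ 5ℚ)
    ∼⟨ +-monoˡ-≲ (λ _ → 5ℚ) (+-monoʳ-≲ (λ j → 5ℚ ℚ.* L j) (stirling m)) ⟩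
  (λ j → 5ℚ ℚ.* L j ℚ.+ (5ℚ ℚ.* logSeq (n !) j ℚ.+ 5ℚ ℚ.* ι n) ℚ.+ 5ℚ)
    ∼⟨ pointwise-≡ (λ j → collect (L j) (logSeq (n !) j) (ι n)) ⟩
  (λ j → 5ℚ ℚ.* (L j ℚ.+ logSeq (n !) j) ℚ.+ 5ℚ ℚ.* (1ℚ ℚ.+ ι n))
    ∼⟨ +-mono-≲ (*-monoʳ-≲ 5ℚ (ι≥0 5) (proj₂ (log-* (suc n) (n !) {{_}} {{n ℕₚ.!≢0}})))
         (pointwise-≡ (λ _ → cong (5ℚ ℚ.*_) (sym (ι-suc n)))) ⟩
  (λ j → 5ℚ ℚ.* logSeq (suc n !) j ℚ.+ 5ℚ ℚ.* ι (suc n)) ∎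
  where
  open ≲-Reasoning
  open ℚ-Solver
  n = suc m
  L = logSeq (suc n)
  c = 5ℚ ℚ.* ι n ℚ.+ 1ℚ
  c≥0 : 0ℚ ℚ.≤ c
  c≥0 = subst (0ℚ ℚ.≤_) (trans (ι-+ (5 ℕ.* n) 1) (cong (ℚ._+ 1ℚ) (ι-* 5 n))) (ι≥0 (5 ℕ.* n ℕ.+ 1))
  split : ∀ a x → (5ℚ ℚ.* (1ℚ ℚ.+ a) ℚ.+ 1ℚ) ℚ.* x ≡ 5ℚ ℚ.* x ℚ.+ (5ℚ ℚ.* a ℚ.+ 1ℚ) ℚ.* x
  split = solve 2 (λ a x → (con 5ℚ :* (con 1ℚ :+ a) :+ con 1ℚ) :* x := con 5ℚ :* x :+ (con 5ℚ :* a :+ con 1ℚ) :* x) refl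
  distribute : ∀ w c x d → w ℚ.+ c ℚ.* (x ℚ.+ d) ≡ w ℚ.+ c ℚ.* x ℚ.+ c ℚ.* d
  distribute = solve 4 (λ w c x d → w :+ c :* (x :+ d) := w :+ c :* x :+ c :* d) refl
  collect : ∀ x y a → 5ℚ ℚ.* x ℚ.+ (5ℚ ℚ.* y ℚ.+ 5ℚ ℚ.* a) ℚ.+ 5ℚ ≡ 5ℚ ℚ.* (x ℚ.+ y) ℚ.+ 5ℚ ℚ.* (1ℚ ℚ.+ a)
  collect = solve 3 (λ x y a →
    con 5ℚ :* x :+ (con 5ℚ :* y :+ con 5ℚ :* a) :+ con 5ℚ := con 5ℚ :* (x :+ y) :+ con 5ℚ :* (con 1ℚ :+ a)) refl

-- The bound of the theorem as a bound on the number of programs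

module _ (q n : ℕ) (2≤q : 2 ≤ q) where
  private
    instance
      q≢0 : NonZero q
      q≢0 = ℕ.>-nonZero (ℕₚ.<⇒≤ 2≤q)
      q!≢0 : NonZero (q !)
      q!≢0 = q ℕₚ.!≢0
      q^n≢0 : NonZero (q ℕ.^ n)
      q^n≢0 = ℕₚ.m^n≢0 q n
      N≢0 : NonZero (q ℕ.^ suc n)
      N≢0 = ℕₚ.m^n≢0 q (suc n)
      M≢0 : NonZero (suc n ℕ.* (q !) ℕ.^ (q ℕ.^ n))
      M≢0 = ℕₚ.m*n≢0 (suc n) ((q !) ℕ.^ (q ℕ.^ n)) {{_}} {{ℕₚ.m^n≢0 (q !) (q ℕ.^ n)}}

    N M : ℕ
    N = q ℕ.^ suc n
    M = suc n ℕ.* (q !) ℕ.^ (q ℕ.^ n)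

  -- In dimension `suc n`, the factor `N` turns 1/q into `q ^ n` and cancels the inverse power of
  -- `q`. The result is the logarithm of the number of instructions, which explains the shape of the
  -- denominator in the theorem.
  N*denom : ∀ j → ι N ℚ.* seq (denom q (suc n)) j ≡ logSeq (suc n) j ℚ.+ ι (q ℕ.^ n) ℚ.* logSeq (q !) j
  N*denom j = begin
    ι N ℚ.* (1/q ℚ.* x ℚ.+ 1/N ℚ.* y)
      ≡⟨ cong (λ a → a ℚ.* (1/q ℚ.* x ℚ.+ 1/N ℚ.* y)) (ι-* q (q ℕ.^ n)) ⟩
    (ι q ℚ.* w) ℚ.* (1/q ℚ.* x ℚ.+ 1/N ℚ.* y)   ≡⟨ expand (ι q) w 1/q 1/N x y ⟩
    ((ι q ℚ.* w) ℚ.* 1/N) ℚ.* y ℚ.+ (ι q ℚ.* 1/q) ℚ.* (w ℚ.* x)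
      ≡⟨ cong₂ (λ a b → a ℚ.* y ℚ.+ b ℚ.* (w ℚ.* x)) (trans (cong (ℚ._* 1/N) (sym (ι-* q (q ℕ.^ n)))) (ι*recip N)) (ι*recip q) ⟩
    1ℚ ℚ.* y ℚ.+ 1ℚ ℚ.* (w ℚ.* x)
      ≡⟨ cong₂ ℚ._+_ (ℚₚ.*-identityˡ y) (ℚₚ.*-identityˡ (w ℚ.* x)) ⟩
    y ℚ.+ w ℚ.* x                                         ∎
    where
    open ≡-Reasoning
    w = ι (q ℕ.^ n)
    x = logSeq (q !) j
    y = logSeq (suc n) j
    1/q = + 1 ℚ./ q
    1/N = inv-^ q (suc n)
    expand : ∀ a w b c x y → (a ℚ.* w) ℚ.* (b ℚ.* x ℚ.+ c ℚ.* y) ≡ ((a ℚ.* w) ℚ.* c) ℚ.* y ℚ.+ (a ℚ.* b) ℚ.* (w ℚ.* x)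
    expand = solve 6 (λ a w b c x y → (a :* w) :* (b :* x :+ c :* y) := ((a :* w) :* c) :* y :+ (a :* b) :* (w :* x)) refl
      where open ℚ-Solver

  log-M : logSeq M ≲ (λ j → ι N ℚ.* seq (denom q (suc n)) j)
  log-M = begin
    logSeq M
      ∼⟨ proj₁ (log-* (suc n) ((q !) ℕ.^ (q ℕ.^ n)) {{_}} {{ℕₚ.m^n≢0 (q !) (q ℕ.^ n)}}) ⟩
    (λ j → logSeq (suc n) j ℚ.+ logSeq ((q !) ℕ.^ (q ℕ.^ n)) j)
      ∼⟨ +-monoʳ-≲ (logSeq (suc n)) (proj₁ (log-^ (q !) (q ℕ.^ n))) ⟩
    (λ j → logSeq (suc n) j ℚ.+ ι (q ℕ.^ n) ℚ.* logSeq (q !) j)   ∼⟨ pointwise-≡ (sym ∘ N*denom) ⟩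
    (λ j → ι N ℚ.* seq (denom q (suc n)) j)                       ∎
    where open ≲-Reasoning

  module _ (k : ℕ) (k≤bound : fromℤ (+ k) ≤ᴿ bound q (suc n) 2≤q) where
    log-M^k : logSeq (M ℕ.^ k) ≲ (λ j → ι N ℚ.* (logSeq N j ℚ.- 1ℚ))
    log-M^k = begin
      logSeq (M ℕ.^ k)                                     ∼⟨ proj₁ (log-^ M k) ⟩
      (λ j → ι k ℚ.* logSeq M j)                           ∼⟨ *-monoʳ-≲ (ι k) (ι≥0 k) log-M ⟩
      (λ j → ι k ℚ.* (ι N ℚ.* seq (denom q (suc n)) j))
        ∼⟨ pointwise-≡ (λ j → swap (ι k) (ι N) (seq (denom q (suc n)) j)) ⟩
      (λ j → ι N ℚ.* (ι k ℚ.* seq (denom q (suc n)) j))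
        ∼⟨ *-monoʳ-≲ (ι N) (ι≥0 N)
             (divide-≤ (fromℤ (+ k)) (numer q (suc n)) (denom q (suc n)) (denom>0 q (suc n) 2≤q) k≤bound) ⟩
      (λ j → ι N ℚ.* (ι (suc n) ℚ.* logSeq q j ℚ.- 1ℚ))
        ∼⟨ *-monoʳ-≲ (ι N) (ι≥0 N) (+-monoˡ-≲ (λ _ → ℚ.- 1ℚ) (proj₂ (log-^ q (suc n)))) ⟩
      (λ j → ι N ℚ.* (logSeq N j ℚ.- 1ℚ))                  ∎
      where
      open ≲-Reasoning
      swap : ∀ a b c → a ℚ.* (b ℚ.* c) ≡ b ℚ.* (a ℚ.* c)
      swap = solve 3 (λ a b c → a :* (b :* c) := b :* (a :* c)) refl
        where open ℚ-Solver

    -- The extra factor `N` is exactly what the surplus log N pays for: 5N (log N - 1) + log N = (5N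
    -- + 1) log N - 5N, which is at most 5 log N! by `stirling`.
    programs-few : ((M ℕ.^ k) ℕ.^ 5) ℕ.* N ≤ (N !) ℕ.^ 5
    programs-few = log-cancel-≤ _ ((N !) ℕ.^ 5) (begin
      logSeq (((M ℕ.^ k) ℕ.^ 5) ℕ.* N)                   ∼⟨ proj₁ (log-* ((M ℕ.^ k) ℕ.^ 5) N) ⟩
      (λ j → logSeq ((M ℕ.^ k) ℕ.^ 5) j ℚ.+ logSeq N j)
        ∼⟨ +-monoˡ-≲ (logSeq N) (proj₁ (log-^ (M ℕ.^ k) 5)) ⟩
      (λ j → 5ℚ ℚ.* logSeq (M ℕ.^ k) j ℚ.+ logSeq N j)
        ∼⟨ +-monoˡ-≲ (logSeq N) (*-monoʳ-≲ 5ℚ (ι≥0 5) log-M^k) ⟩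
      (λ j → 5ℚ ℚ.* (ι N ℚ.* (logSeq N j ℚ.- 1ℚ)) ℚ.+ logSeq N j)
        ∼⟨ pointwise-≡ (λ j → rearrange (ι N) (logSeq N j)) ⟩
      (λ j → (5ℚ ℚ.* ι N ℚ.+ 1ℚ) ℚ.* logSeq N j ℚ.+ ℚ.- (5ℚ ℚ.* ι N))
        ∼⟨ +-monoˡ-≲ (λ _ → ℚ.- (5ℚ ℚ.* ι N)) stirling-N ⟩
      (λ j → 5ℚ ℚ.* logSeq (N !) j ℚ.+ 5ℚ ℚ.* ι N ℚ.+ ℚ.- (5ℚ ℚ.* ι N))
        ∼⟨ pointwise-≡ (λ j → cancel (logSeq (N !) j) (ι N)) ⟩
      (λ j → 5ℚ ℚ.* logSeq (N !) j)                      ∼⟨ proj₂ (log-^ (N !) 5) ⟩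
      logSeq ((N !) ℕ.^ 5)                               ∎)
      where
      open ≲-Reasoning
      open ℚ-Solver
      instance
        M^k≢0 : NonZero (M ℕ.^ k)
        M^k≢0 = ℕₚ.m^n≢0 M k
        M^5k≢0 : NonZero ((M ℕ.^ k) ℕ.^ 5)
        M^5k≢0 = ℕₚ.m^n≢0 (M ℕ.^ k) 5
        N!≢0 : NonZero (N !)
        N!≢0 = N ℕₚ.!≢0
        N!^5≢0 : NonZero ((N !) ℕ.^ 5)
        N!^5≢0 = ℕₚ.m^n≢0 (N !) 5
      stirling-N : (λ j → (5ℚ ℚ.* ι N ℚ.+ 1ℚ) ℚ.* logSeq N j) ≲ (λ j → 5ℚ ℚ.* logSeq (N !) j ℚ.+ 5ℚ ℚ.* ι N)
      stirling-N = subst (λ m → (λ j → (5ℚ ℚ.* ι m ℚ.+ 1ℚ) ℚ.* logSeq m j) ≲ (λ j → 5ℚ ℚ.* logSeq (m !) j ℚ.+ 5ℚ ℚ.* ι m))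
        (ℕₚ.suc-pred N) (stirling (ℕ.pred N))
      rearrange : ∀ a x → 5ℚ ℚ.* (a ℚ.* (x ℚ.- 1ℚ)) ℚ.+ x ≡ (5ℚ ℚ.* a ℚ.+ 1ℚ) ℚ.* x ℚ.+ ℚ.- (5ℚ ℚ.* a)
      rearrange = solve 2 (λ a x →
        con 5ℚ :* (a :* (x :- con 1ℚ)) :+ x := (con 5ℚ :* a :+ con 1ℚ) :* x :+ :- (con 5ℚ :* a)) refl
      cancel : ∀ y a → 5ℚ ℚ.* y ℚ.+ 5ℚ ℚ.* a ℚ.+ ℚ.- (5ℚ ℚ.* a) ≡ 5ℚ ℚ.* y
      cancel = solve 2 (λ y a → con 5ℚ :* y :+ con 5ℚ :* a :+ :- (con 5ℚ :* a) := con 5ℚ :* y) refl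

-- From the count to the limit

^5-distrib : ∀ a t → (a ℕ.* t) ℕ.^ 5 ≡ (a ℕ.^ 5) ℕ.* (t ℕ.^ 5)
^5-distrib = solve 2 (λ a t → (a :* t) :^ 5 := (a :^ 5) :* (t :^ 5)) refl
  where open ℕ-Solver

-- The natural number `t` stands in for the real fifth root of `N`: if b < at, then b^5 < a^5 t^5 ≤
-- a^5 N, against the second hypothesis.
fifth-root : ∀ {a b t N} → t ℕ.^ 5 ≤ N → (a ℕ.^ 5) ℕ.* N ≤ b ℕ.^ 5 → a ℕ.* t ≤ b
fifth-root {a} {b} {t} {N} t⁵≤N a⁵N≤b⁵ with ℕₚ.≤-<-connex (a ℕ.* t) b
... | inj₁ at≤b = at≤b
... | inj₂ b<at = contradiction (ℕₚ.^-monoˡ-< 5 b<at) (ℕₚ.≤⇒≯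
  (subst (_≤ b ℕ.^ 5) (sym (^5-distrib a t)) (ℕₚ.≤-trans (ℕₚ.*-monoʳ-≤ (a ℕ.^ 5) t⁵≤N) a⁵N≤b⁵)))

n≤q^n : ∀ {q} → 2 ≤ q → ∀ n → n ≤ q ℕ.^ n
n≤q^n 2≤q zero = z≤n
n≤q^n {q} 2≤q (suc n) = begin
  suc n
    ≤⟨ ℕₚ.+-mono-≤ (ℕₚ.m^n>0 q {{ℕ.>-nonZero (ℕₚ.<⇒≤ 2≤q)}} n) (n≤q^n 2≤q n) ⟩
  q ℕ.^ n ℕ.+ q ℕ.^ n            ≡⟨ cong (q ℕ.^ n ℕ.+_) (ℕₚ.+-identityʳ (q ℕ.^ n)) ⟨
  2 ℕ.* q ℕ.^ n                  ≤⟨ ℕₚ.*-monoˡ-≤ (q ℕ.^ n) 2≤q ⟩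
  q ℕ.* q ℕ.^ n                  ∎
  where open ℕₚ.≤-Reasoning

-- The ratio c/T lies between 1 - B/T and 1, and B/T is at most 1/(t + 1); both estimates are
-- checked after multiplication by `T`.
ratio-near-1 : ∀ {c B T} t ε .{{_ : NonZero T}} → c ≤ T → T ≤ c ℕ.+ B → B ℕ.* suc t ≤ T → u t ℚ.< ε →
               ∣ (+ c ℚ./ T) ℚ.- 1ℚ ∣ ℚ.< ε
ratio-near-1 {c} {B} {T} t ε c≤T T≤c+B Bt≤T ut<ε = ∣-∣-< x 1ℚ ε
  (ℚₚ.≤-<-trans (shift {x} {1ℚ} x≤1+u) ut<ε)
  (ℚₚ.≤-<-trans (shift {1ℚ} {x} 1≤x+u) ut<ε)
  where
  x = + c ℚ./ T
  T⁺ = ℚ.positive (ι>0 T)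
  shift : ∀ {a b d} → a ℚ.≤ b ℚ.+ d → a ℚ.- b ℚ.≤ d
  shift {a} {b} {d} h = subst (a ℚ.- b ℚ.≤_) (simp b d) (ℚₚ.+-monoˡ-≤ (ℚ.- b) h)
    where
    simp : ∀ b d → b ℚ.+ d ℚ.- b ≡ d
    simp = solve 2 (λ b d → b :+ d :- b := d) refl
      where open ℚ-Solver
  x≤1+u : x ℚ.≤ 1ℚ ℚ.+ u t
  x≤1+u = ℚₚ.≤-trans
    (ℚₚ.*-cancelˡ-≤-pos (ι T) {{T⁺}} (subst₂ ℚ._≤_ (sym (ι*ratio c T)) (sym (ℚₚ.*-identityʳ (ι T))) (ι-mono c≤T)))
    (subst (ℚ._≤ 1ℚ ℚ.+ u t) (ℚₚ.+-identityʳ 1ℚ) (ℚₚ.+-monoʳ-≤ 1ℚ (u≥0 t)))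
  B≤Tu : ι B ℚ.≤ ι T ℚ.* u t
  B≤Tu = subst (ℚ._≤ ι T ℚ.* u t)
    (trans (cong (ℚ._* u t) (ι-* B (suc t))) (trans (ℚₚ.*-assoc (ι B) (ι (suc t)) (u t))
      (trans (cong (ι B ℚ.*_) (ι*u t)) (ℚₚ.*-identityʳ (ι B)))))
    (ℚₚ.*-monoʳ-≤-nonNeg (u t) {{ℚ.nonNegative (u≥0 t)}} (ι-mono Bt≤T))
  1≤x+u : 1ℚ ℚ.≤ x ℚ.+ u t
  1≤x+u = ℚₚ.*-cancelˡ-≤-pos (ι T) {{T⁺}} (begin
    ι T ℚ.* 1ℚ                    ≡⟨ ℚₚ.*-identityʳ (ι T) ⟩
    ι T                           ≤⟨ ι-mono T≤c+B ⟩
    ι (c ℕ.+ B)                   ≡⟨ ι-+ c B ⟩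
    ι c ℚ.+ ι B                   ≤⟨ ℚₚ.+-monoʳ-≤ (ι c) B≤Tu ⟩
    ι c ℚ.+ ι T ℚ.* u t           ≡⟨ cong (ℚ._+ ι T ℚ.* u t) (ι*ratio c T) ⟨
    ι T ℚ.* x ℚ.+ ι T ℚ.* u t     ≡⟨ ℚₚ.*-distribˡ-+ (ι T) x (u t) ⟨
    ι T ℚ.* (x ℚ.+ u t)           ∎)
    where open ℚₚ.≤-Reasoning

module _ {q : ℕ} (2≤q : 2 ≤ q) {A : Set} (A↔Fin : A ↔ Fin q) (n : ℕ) where
  open Programs A↔Fin n

  few-simple : ∀ t κ {c} → t ℕ.^ 5 ≤ suc n → fromℤ κ ≤ᴿ bound q (suc n) 2≤q →
    HasCardinality (permutationsWith A (suc n) (ComplexityAtLeast (κ ℤ.+ + 1))) c →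
    ∃ λ B → total ≤ c ℕ.+ B × B ℕ.* t ≤ total
  few-simple t (+ k) t⁵≤n k≤bound count = instructionCount ℕ.^ k
    , total≤count+ count (program k) (unlisted⇒complex k)
    , fifth-root {a = instructionCount ℕ.^ k} (ℕₚ.≤-trans t⁵≤n (n≤q^n 2≤q (suc n)))
        (programs-few q n 2≤q k k≤bound)
  -- A negative floor does occur: for q = 2 in dimension 1 the numerator is log 2 - 1. The threshold
  -- is then at most 0, so every permutation meets it and the list of exceptions is empty.
  few-simple t -[1+ k ] _ _ count = 0
    , total≤count+ count (λ ()) (λ _ _ L _ →
        ℤₚ.≤-trans (subst (ℤ._≤ + 0) (ℤₚ.+-comm (+ 1) -[1+ k ])
          (ℤₚ.i≤j⇒i-j≤0 {+ 1} {+ suc k} (ℤ.+≤+ (s≤s z≤n)))) (ℤ.+≤+ z≤n))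
    , z≤n

proposition3 : (q : ℕ) (2≤q : 2 ≤ q) (A : Set) → A ↔ Fin q →
    (K : ℕ → ℤ) → (∀ n → 1 ≤ n → IsFloor (bound q n 2≤q) (K n)) →
    (c : ℕ → ℕ) →
    (∀ n → 1 ≤ n →
    HasCardinality (permutationsWith A n (ComplexityAtLeast (K n ℤ.+ + 1))) (c n)) →
    TendsTo (λ n → proportion q n (c n)) 1ℚ
-- With 1/(N + 1) < ε, taking t = N + 1 requires t^5 to be at most the dimension, which in turn is
-- at most `q ^ n`; the fraction of exceptions is then at most 1/t.
proposition3 q 2≤q A A↔Fin K K-floor c c-count ε ε>0 = suc N ℕ.^ 5 , close
  where
  N = proj₁ (u-small ε ε>0)
  close : ∀ n → suc N ℕ.^ 5 ≤ n → ∣ proportion q n (c n) ℚ.- 1ℚ ∣ ℚ.< ε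
  close zero    ()
  close (suc n) large =
    let B , total≤c+B , Bt≤total = few-simple 2≤q A↔Fin n (suc N) (K (suc n)) large
          (proj₁ (K-floor (suc n) (s≤s z≤n))) (c-count (suc n) (s≤s z≤n))
    in ratio-near-1 N ε {{(q ℕ.^ suc n) ℕₚ.!≢0}}
         (Programs.count≤total A↔Fin n (c-count (suc n) (s≤s z≤n)))
         total≤c+B Bt≤total (proj₂ (u-small ε ε>0) N ℕₚ.≤-refl)
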